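{- Let $L,H$ be causal models (in a Markov category) such that $V_H^{\rm nin}\subseteq V_H^{\rm out}$, with signatures $\Sigma_L,\Sigma_H$, and let $\mathbf S_L,\mathbf S_H$ be the free Markov categories on $\Sigma_L,\Sigma_H$. A cd-functor $\pi_S\colon\mathbf S_H\to\mathbf S_L$ is structurally well-behaved if and only if $\pi_S(D_H)$ is again a network diagram in $\mathbf S_L$, where $D_H\colon V_H^{\rm in}\to V_H^{\rm out}$ is the network diagram of $H$, and $\pi_S(V_H^{\rm in})=V_L^{\rm in}$, $\pi_S(V_H^{\rm out})\subseteq V_L^{\rm out}$ and $\pi_S(V_H^{\rm nin})\subseteq V_L^{\rm nin}$.
   Context: **Categories.** A Markov category is a symmetric monoidal category with terminal unit $I$ in which each object has a commutative comonoid structure (copy $A\to A\otimes A$, discard $A\to I$) compatible with $\otimes$. A cd-functor is a strong symmetric monoidal functor preserving copy and discard. **Causal models.** An open DAG is a finite DAG $G$ with vertex set $V$ (variables) and a subset $V^{\rm in}\subseteq V$ of parentless vertices (inputs); $V^{\rm nin}=V\setminus V^{\rm in}$. Its signature $\Sigma$ has an object $X$ for each vertex and a generator $c_X\colon\mathrm{Pa}(X)\to X$ for each $X\in V^{\rm nin}$. A causal model of $G$ in a Markov category $\mathcal C$ is an assignment of objects of $\mathcal C$ to variables and morphisms of $\mathcal C$ to the generators $c_X$ of the corresponding types, with a specified subset $V^{\rm out}\subseteq V$ of outputs. $G_L$, $G_H$ denote the DAGs of $L$, $H$. **Free Markov category.** The objects of the free Markov category on $\Sigma$ are finite lists of variables;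 morphisms are string diagrams built from the generators $c_X$, copies and discards, modulo the Markov category axioms (in particular $\mathrm{disc}\circ c_X=\mathrm{disc}$). A condition such as $\pi_S(S)\subseteq T$, for sets of variables $S,T$, means that the list obtained by concatenating the lists $\pi_S(X)$, $X\in S$, has no repetitions and its entries lie in $T$; $\pi_S(S)=T$ means that moreover every element of $T$ occurs (order is ignored). **Network diagrams.** A network diagram is a string diagram built from single-output boxes, copies and discards with labelled wires such that wires not connected by copy maps have distinct labels, and each label appears at most once as an output of the diagram and at most once as an input to any given box. It is normalised if every non-input variable in it has a path to an output. The network diagram $D_H\colon V_H^{\rm in}\to V_H^{\rm out}$ wires together, with copy maps, one box $c_X$ for each non-input variable $X$ with a directed path (possibly of length 0) to $V_H^{\rm out}$, copies each output variable once more to form an output, and discards inputs with no path to the outputs. **Well-behavedness (Markov type).** For a family $(\pi(X))_{X\in V_H}$ of disjoint subsets of $V_L$, let $\mathsf M(X)$ be the set of $Z\in V_L$ for which there is a directed path (possibly of length 0) in $G_L$ from $Z$ to an element of $\pi(X)$ not passing through $\pi(\mathrm{Pa}(X))=\bigcup_{Y\in\mathrm{Pa}(X)}\pi(Y)$. A cd-functor $\pi_S\colon\mathbf S_H\to\mathbf S_L$ is *structurally well-behaved* if each $\pi_S(c_X)$, $X\in V_H^{\rm nin}$, is a normalised network diagram in $\mathbf S_L$; the $\pi(X):=\pi_S(X)$, $X\in V_H$, are pairwise disjoint subsets of $V_L$ with $\pi(V_H^{\rm in})=V_L^{\rm in}$ and $\pi(V_H^{\rm out})\subseteq V_L^{\rm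 out}$; and $\mathsf M(X)\cap\mathsf M(Y)=\emptyset$ for all $X\ne Y$ in $V_H$. -}

module Defs where

open import Level using (Level; _⊔_; suc; 0ℓ)
open import Data.Nat.Base using (ℕ)
open import Data.Nat.Properties using (suc-injective)
open import Data.Fin.Base using (Fin)
open import Data.Fin.Properties using (any?; _≟_)
open import Data.Fin.Induction using (spo-wellFounded; spo-noetherian)
open import Data.Fin.Subset using (Subset; ∁) renaming (_∈_ to _∈ˢ_; _∉_ to _∉ˢ_)
open import Data.Fin.Subset.Properties using () renaming (_∈?_ to _∈ˢ?_)
open import Data.List.Base using (List; []; _∷_; [_]; _++_; _ʳ++_; length; filter; allFin; foldr; map; concatMap)
open import Data.List.Properties using (++-assoc; ++-identityʳ)
open import Data.List.Membership.Propositional using (_∈_; _∉_)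
open import Data.List.Membership.Propositional.Properties using (∈-∃++; ∈-filter⁺; ∈-filter⁻; ∈-allFin)
open import Data.List.Relation.Unary.Any using (here; there) renaming (any? to anyˡ?)
open import Data.List.Relation.Unary.Any.Properties using (reverseAcc⁺)
open import Data.List.Relation.Unary.All using (All)
open import Data.List.Relation.Unary.Unique.Propositional using (Unique)
open import Data.List.Relation.Binary.Disjoint.Propositional using (Disjoint)
open import Data.List.Relation.Binary.Subset.Propositional using (_⊆_)
open import Data.List.Relation.Binary.Permutation.Propositional using (_↭_; ↭-refl; ↭-trans; ↭-sym; ↭-prep; ↭-reflexive)
open import Data.List.Relation.Binary.Permutation.Propositional.Properties using (shift; ∈-resp-↭; ↭-length)
open import Data.Product.Base using (Σ-syntax; ∃-syntax; _×_; _,_; proj₁; proj₂)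
open import Data.Sum.Base using (_⊎_; inj₁; inj₂)
open import Function.Base using (flip)
open import Induction.WellFounded using (Acc; acc)
open import Relation.Nullary using (¬_; Dec; yes; no; contradiction)
open import Relation.Nullary.Decidable using (map′; ¬?; _×-dec_; _⊎-dec_)
open import Relation.Unary using (Pred; U)
open import Relation.Binary.Core using (Rel)
open import Relation.Binary.Definitions using (Decidable)
open import Relation.Binary.Structures using (IsEquivalence; IsStrictPartialOrder)
open import Relation.Binary.Construct.Closure.Transitive using (TransClosure) renaming ([_] to [_]⁺; _++_ to _++⁺_)
open import Relation.Binary.PropositionalEquality.Core using (_≡_; _≢_; refl; sym; trans; cong₂; resp₂)
open import Relation.Binary.PropositionalEquality.Properties using (isEquivalence)

------------------------------------------------------------------------
-- Markov categories and cd-functors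

record SymmetricMonoidalCategory (o ℓ e : Level) : Set (suc (o ⊔ ℓ ⊔ e)) where
  infix  4 _≈_ _⇒_
  infixr 9 _∘_
  infixr 10 _⊗₀_ _⊗₁_
  field
    Obj  : Set o
    _⇒_  : Obj → Obj → Set ℓ
    _≈_  : ∀ {A B} → Rel (A ⇒ B) e
    id   : ∀ {A} → A ⇒ A
    _∘_  : ∀ {A B C} → B ⇒ C → A ⇒ B → A ⇒ C

    equiv     : ∀ {A B} → IsEquivalence (_≈_ {A} {B})
    ∘-resp-≈  : ∀ {A B C} {f h : B ⇒ C} {g i : A ⇒ B} → f ≈ h → g ≈ i → f ∘ g ≈ h ∘ i
    assoc     : ∀ {A B C D} {f : A ⇒ B} {g : B ⇒ C} {h : C ⇒ D} → (h ∘ g) ∘ f ≈ h ∘ (g ∘ f)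
    identityˡ : ∀ {A B} {f : A ⇒ B} → id ∘ f ≈ f
    identityʳ : ∀ {A B} {f : A ⇒ B} → f ∘ id ≈ f

    unit  : Obj
    _⊗₀_  : Obj → Obj → Obj
    _⊗₁_  : ∀ {A B C D} → A ⇒ B → C ⇒ D → A ⊗₀ C ⇒ B ⊗₀ D

    ⊗-resp-≈       : ∀ {A B C D} {f h : A ⇒ B} {g i : C ⇒ D} → f ≈ h → g ≈ i → f ⊗₁ g ≈ h ⊗₁ i
    ⊗-identity     : ∀ {A B} → id {A} ⊗₁ id {B} ≈ id
    ⊗-homomorphism : ∀ {A B C A′ B′ C′} {f : A ⇒ B} {g : B ⇒ C} {f′ : A′ ⇒ B′} {g′ : B′ ⇒ C′} →
                     (g ∘ f) ⊗₁ (g′ ∘ f′) ≈ (g ⊗₁ g′) ∘ (f ⊗₁ f′)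

    λ⇒ : ∀ {A} → unit ⊗₀ A ⇒ A
    λ⇐ : ∀ {A} → A ⇒ unit ⊗₀ A
    ρ⇒ : ∀ {A} → A ⊗₀ unit ⇒ A
    ρ⇐ : ∀ {A} → A ⇒ A ⊗₀ unit
    α⇒ : ∀ {A B C} → (A ⊗₀ B) ⊗₀ C ⇒ A ⊗₀ (B ⊗₀ C)
    α⇐ : ∀ {A B C} → A ⊗₀ (B ⊗₀ C) ⇒ (A ⊗₀ B) ⊗₀ C
    σ  : ∀ {A B} → A ⊗₀ B ⇒ B ⊗₀ A

    λ-isoˡ : ∀ {A} → λ⇐ ∘ λ⇒ ≈ id {unit ⊗₀ A}
    λ-isoʳ : ∀ {A} → λ⇒ ∘ λ⇐ ≈ id {A}
    ρ-isoˡ : ∀ {A} → ρ⇐ ∘ ρ⇒ ≈ id {A ⊗₀ unit}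
    ρ-isoʳ : ∀ {A} → ρ⇒ ∘ ρ⇐ ≈ id {A}
    α-isoˡ : ∀ {A B C} → α⇐ ∘ α⇒ ≈ id {(A ⊗₀ B) ⊗₀ C}
    α-isoʳ : ∀ {A B C} → α⇒ ∘ α⇐ ≈ id {A ⊗₀ (B ⊗₀ C)}
    σ-iso  : ∀ {A B} → σ ∘ σ ≈ id {A ⊗₀ B}

    λ-natural : ∀ {A B} {f : A ⇒ B} → λ⇒ ∘ (id ⊗₁ f) ≈ f ∘ λ⇒
    ρ-natural : ∀ {A B} {f : A ⇒ B} → ρ⇒ ∘ (f ⊗₁ id) ≈ f ∘ ρ⇒
    α-natural : ∀ {A B C A′ B′ C′} {f : A ⇒ A′} {g : B ⇒ B′} {h : C ⇒ C′} →
                α⇒ ∘ ((f ⊗₁ g) ⊗₁ h) ≈ (f ⊗₁ (g ⊗₁ h)) ∘ α⇒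
    σ-natural : ∀ {A B A′ B′} {f : A ⇒ A′} {g : B ⇒ B′} → σ ∘ (f ⊗₁ g) ≈ (g ⊗₁ f) ∘ σ

    triangle : ∀ {A B} → (id {A} ⊗₁ λ⇒ {B}) ∘ α⇒ ≈ ρ⇒ ⊗₁ id
    pentagon : ∀ {A B C D} →
               (id {A} ⊗₁ α⇒ {B} {C} {D}) ∘ α⇒ ∘ (α⇒ ⊗₁ id) ≈ α⇒ ∘ α⇒
    hexagon  : ∀ {A B C} →
               (id {B} ⊗₁ σ {A} {C}) ∘ α⇒ ∘ (σ {A} {B} ⊗₁ id) ≈ α⇒ ∘ σ {A} {B ⊗₀ C} ∘ α⇒

  IsIso : ∀ {A B} → A ⇒ B → Set (ℓ ⊔ e)
  IsIso {A} {B} f = Σ[ g ∈ B ⇒ A ] (g ∘ f ≈ id × f ∘ g ≈ id)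

  ⨂ : List Obj → Obj
  ⨂ = foldr _⊗₀_ unit

record MarkovCategory (o ℓ e : Level) : Set (suc (o ⊔ ℓ ⊔ e)) where
  field
    symmetricMonoidal : SymmetricMonoidalCategory o ℓ e
  open SymmetricMonoidalCategory symmetricMonoidal public
  field
    copy    : ∀ {A} → A ⇒ A ⊗₀ A
    discard : ∀ {A} → A ⇒ unit

    discard-unique : ∀ {A} (f : A ⇒ unit) → f ≈ discard

    copy-counitˡ : ∀ {A} → λ⇒ ∘ (discard ⊗₁ id) ∘ copy ≈ id {A}
    copy-counitʳ : ∀ {A} → ρ⇒ ∘ (id ⊗₁ discard) ∘ copy ≈ id {A}
    copy-assoc   : ∀ {A} → α⇒ ∘ (copy ⊗₁ id) ∘ copy ≈ (id ⊗₁ copy) ∘ copy {A}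
    copy-comm    : ∀ {A} → σ ∘ copy ≈ copy {A}

    copy-unit : copy ≈ λ⇐ {unit}
    copy-⊗    : ∀ {A B} →
                copy {A ⊗₀ B} ≈ α⇐ ∘ (id ⊗₁ (α⇒ ∘ (σ ⊗₁ id) ∘ α⇐)) ∘ α⇒ ∘ (copy ⊗₁ copy)

record CDFunctor {o ℓ e o′ ℓ′ e′} (𝒞 : MarkovCategory o ℓ e) (𝒟 : MarkovCategory o′ ℓ′ e′)
                 : Set (o ⊔ ℓ ⊔ e ⊔ o′ ⊔ ℓ′ ⊔ e′) where
  private
    module C = MarkovCategory 𝒞
  open MarkovCategory 𝒟
  field
    F₀ : C.Obj → Obj
    F₁ : ∀ {A B} → A C.⇒ B → F₀ A ⇒ F₀ B

    F-resp-≈     : ∀ {A B} {f g : A C.⇒ B} → f C.≈ g → F₁ f ≈ F₁ g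
    identity     : ∀ {A} → F₁ (C.id {A}) ≈ id
    homomorphism : ∀ {A B C} {f : A C.⇒ B} {g : B C.⇒ C} → F₁ (g C.∘ f) ≈ F₁ g ∘ F₁ f

    ε     : unit ⇒ F₀ C.unit
    μ     : ∀ A B → F₀ A ⊗₀ F₀ B ⇒ F₀ (A C.⊗₀ B)
    ε-iso : IsIso ε
    μ-iso : ∀ A B → IsIso (μ A B)

    μ-natural : ∀ {A B A′ B′} {f : A C.⇒ A′} {g : B C.⇒ B′} →
                μ A′ B′ ∘ (F₁ f ⊗₁ F₁ g) ≈ F₁ (f C.⊗₁ g) ∘ μ A B
    μ-assoc   : ∀ {A B C} →
                F₁ C.α⇒ ∘ μ (A C.⊗₀ B) C ∘ (μ A B ⊗₁ id) ≈ μ A (B C.⊗₀ C) ∘ (id ⊗₁ μ B C) ∘ α⇒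
    μ-unitˡ   : ∀ {A} → F₁ C.λ⇒ ∘ μ C.unit A ∘ (ε ⊗₁ id) ≈ λ⇒
    μ-unitʳ   : ∀ {A} → F₁ C.ρ⇒ ∘ μ A C.unit ∘ (id ⊗₁ ε) ≈ ρ⇒
    μ-sym     : ∀ {A B} → F₁ C.σ ∘ μ A B ≈ μ B A ∘ σ

    F-copy    : ∀ {A} → F₁ (C.copy {A}) ≈ μ A A ∘ copy
    F-discard : ∀ {A} → F₁ (C.discard {A}) ≈ ε ∘ discard

------------------------------------------------------------------------
-- Open DAGs and causal models

elements : ∀ {n} → Subset n → List (Fin n)
elements S = filter (_∈ˢ? S) (allFin _)

record OpenDAG : Set₁ where
  infix 4 _⟶_ _⟶?_
  field
    size : ℕ

  Vertex : Set
  Vertex = Fin size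

  field
    _⟶_               : Rel Vertex 0ℓ
    _⟶?_              : Decidable _⟶_
    acyclic           : ∀ {X} → ¬ TransClosure _⟶_ X X
    inputs            : Subset size
    inputs-parentless : ∀ {X Y} → Y ∈ˢ inputs → ¬ (X ⟶ Y)

  nonInputs : Subset size
  nonInputs = ∁ inputs

  Pa : Vertex → List Vertex
  Pa Y = filter (_⟶? Y) (allFin size)

  -- Directed paths, possibly of length 0, all of whose vertices (both
  -- endpoints included) satisfy P.
  data Path {p} (P : Pred Vertex p) : Rel Vertex p where
    stop : ∀ {X} → P X → Path P X X
    step : ∀ {X Y Z} → P X → X ⟶ Y → Path P Y Z → Path P X Z

  Reaches : Subset size → Pred Vertex 0ℓ
  Reaches S X = ∃[ Y ] (Y ∈ˢ S × Path U X Y)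

record CausalModel {o ℓ e} (𝒞 : MarkovCategory o ℓ e) : Set (suc 0ℓ ⊔ o ⊔ ℓ) where
  open MarkovCategory 𝒞
  field
    dag : OpenDAG
  open OpenDAG dag public
  field
    object    : Vertex → Obj
    mechanism : ∀ X → X ∉ˢ inputs → ⨂ (map object (Pa X)) ⇒ object X
    outputs   : Subset size

------------------------------------------------------------------------
-- The free Markov category on the signature of an open DAG

module Free (G : OpenDAG) where
  open OpenDAG G

  infixr 9 _∘_
  infixr 10 _⊗_
  infix 4 _≈_

  private
    variable
      A B C D A′ B′ C′ : List Vertex

  data Diagram : List Vertex → List Vertex → Set where
    id      : Diagram A A
    _∘_     : Diagram B C → Diagram A B → Diagram A C
    _⊗_     : Diagram A B → Diagram C D → Diagram (A ++ C) (B ++ D)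
    σ       : ∀ A B → Diagram (A ++ B) (B ++ A)
    copy    : ∀ A → Diagram A (A ++ A)
    discard : ∀ A → Diagram A []
    c       : ∀ X → X ∉ˢ inputs → Diagram (Pa X) [ X ]

  -- Lists form a strict monoid only up to propositional equality, so the
  -- associator and the right unitor are identities along such equalities.
  coe : A ≡ B → Diagram A B
  coe refl = id

  α⇒ : ∀ A B C → Diagram ((A ++ B) ++ C) (A ++ (B ++ C))
  α⇒ A B C = coe (++-assoc A B C)

  α⇐ : ∀ A B C → Diagram (A ++ (B ++ C)) ((A ++ B) ++ C)
  α⇐ A B C = coe (sym (++-assoc A B C))

  ρ⇒ : ∀ A → Diagram (A ++ []) A
  ρ⇒ A = coe (++-identityʳ A)

  ρ⇐ : ∀ A → Diagram A (A ++ [])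
  ρ⇐ A = coe (sym (++-identityʳ A))

  data _≈_ : Diagram A B → Diagram A B → Set where
    ≈-refl  : {f : Diagram A B} → f ≈ f
    ≈-sym   : {f g : Diagram A B} → f ≈ g → g ≈ f
    ≈-trans : {f g h : Diagram A B} → f ≈ g → g ≈ h → f ≈ h

    ∘-resp-≈ : {f h : Diagram B C} {g i : Diagram A B} → f ≈ h → g ≈ i → f ∘ g ≈ h ∘ i
    ⊗-resp-≈ : {f h : Diagram A B} {g i : Diagram C D} → f ≈ h → g ≈ i → f ⊗ g ≈ h ⊗ i

    assoc     : {f : Diagram A B} {g : Diagram B C} {h : Diagram C D} → (h ∘ g) ∘ f ≈ h ∘ (g ∘ f)
    identityˡ : {f : Diagram A B} → id ∘ f ≈ f
    identityʳ : {f : Diagram A B} → f ∘ id ≈ f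

    ⊗-identity     : id {A} ⊗ id {B} ≈ id
    ⊗-homomorphism : {f : Diagram A B} {g : Diagram B C} {f′ : Diagram A′ B′} {g′ : Diagram B′ C′} →
                     (g ∘ f) ⊗ (g′ ∘ f′) ≈ (g ⊗ g′) ∘ (f ⊗ f′)

    ⊗-unitˡ : {f : Diagram A B} → id {[]} ⊗ f ≈ f
    ⊗-unitʳ : {f : Diagram A B} → ρ⇒ B ∘ (f ⊗ id {[]}) ≈ f ∘ ρ⇒ A
    ⊗-assoc : {f : Diagram A A′} {g : Diagram B B′} {h : Diagram C C′} →
              α⇒ A′ B′ C′ ∘ ((f ⊗ g) ⊗ h) ≈ (f ⊗ (g ⊗ h)) ∘ α⇒ A B C

    σ-iso     : σ B A ∘ σ A B ≈ id
    σ-natural : {f : Diagram A A′} {g : Diagram B B′} → σ A′ B′ ∘ (f ⊗ g) ≈ (g ⊗ f) ∘ σ A B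
    σ-hexagon : (id {B} ⊗ σ A C) ∘ α⇒ B A C ∘ (σ A B ⊗ id {C}) ≈ α⇒ B C A ∘ σ A (B ++ C) ∘ α⇒ A B C

    discard-unique : (f : Diagram A []) → f ≈ discard A

    copy-counitˡ : (discard A ⊗ id) ∘ copy A ≈ id
    copy-counitʳ : ρ⇒ A ∘ (id ⊗ discard A) ∘ copy A ≈ id
    copy-assoc   : α⇒ A A A ∘ (copy A ⊗ id) ∘ copy A ≈ (id ⊗ copy A) ∘ copy A
    copy-comm    : σ A A ∘ copy A ≈ copy A
    copy-⊗       : copy (A ++ B) ≈ α⇐ A B (A ++ B)
                                   ∘ (id {A} ⊗ (α⇒ B A B ∘ (σ A B ⊗ id {B}) ∘ α⇐ A B B))
                                   ∘ α⇒ A A (B ++ B)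
                                   ∘ (copy A ⊗ copy B)

  private
    coe-∘ : (p : A ≡ B) (q : B ≡ C) → coe q ∘ coe p ≈ coe (trans p q)
    coe-∘ refl refl = identityˡ

    coe-⊗ : (p : A ≡ B) (q : C ≡ D) → coe p ⊗ coe q ≈ coe (cong₂ _++_ p q)
    coe-⊗ refl refl = ⊗-identity

    coe-irrelevant : (p q : A ≡ B) → coe p ≈ coe q
    coe-irrelevant refl refl = ≈-refl

    coe-invˡ : (p : A ≡ B) → coe (sym p) ∘ coe p ≈ id
    coe-invˡ refl = identityˡ

    coe-invʳ : (p : A ≡ B) → coe p ∘ coe (sym p) ≈ id
    coe-invʳ refl = identityˡ

    IsCoe : Diagram A B → Set
    IsCoe f = ∃[ p ] f ≈ coe p

    id-isCoe : IsCoe (id {A})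
    id-isCoe = refl , ≈-refl

    coe-isCoe : (p : A ≡ B) → IsCoe (coe p)
    coe-isCoe p = p , ≈-refl

    ∘-isCoe : {f : Diagram A B} {g : Diagram B C} → IsCoe g → IsCoe f → IsCoe (g ∘ f)
    ∘-isCoe (q , g≈q) (p , f≈p) = trans p q , ≈-trans (∘-resp-≈ g≈q f≈p) (coe-∘ p q)

    ⊗-isCoe : {f : Diagram A B} {g : Diagram C D} → IsCoe f → IsCoe g → IsCoe (f ⊗ g)
    ⊗-isCoe (p , f≈p) (q , g≈q) = cong₂ _++_ p q , ≈-trans (⊗-resp-≈ f≈p g≈q) (coe-⊗ p q)

    isCoe-unique : {f g : Diagram A B} → IsCoe f → IsCoe g → f ≈ g
    isCoe-unique (p , f≈p) (q , g≈q) = ≈-trans f≈p (≈-trans (coe-irrelevant p q) (≈-sym g≈q))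

  symmetricMonoidal : SymmetricMonoidalCategory 0ℓ 0ℓ 0ℓ
  symmetricMonoidal = record
    { Obj            = List Vertex
    ; _⇒_            = Diagram
    ; _≈_            = _≈_
    ; id             = id
    ; _∘_            = _∘_
    ; equiv          = record { refl = ≈-refl ; sym = ≈-sym ; trans = ≈-trans }
    ; ∘-resp-≈       = ∘-resp-≈
    ; assoc          = assoc
    ; identityˡ      = identityˡ
    ; identityʳ      = identityʳ
    ; unit           = []
    ; _⊗₀_           = _++_
    ; _⊗₁_           = _⊗_
    ; ⊗-resp-≈       = ⊗-resp-≈
    ; ⊗-identity     = ⊗-identity
    ; ⊗-homomorphism = ⊗-homomorphism
    ; λ⇒             = id
    ; λ⇐             = id
    ; ρ⇒             = λ {A} → ρ⇒ A
    ; ρ⇐             = λ {A} → ρ⇐ A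
    ; α⇒             = λ {A} {B} {C} → α⇒ A B C
    ; α⇐             = λ {A} {B} {C} → α⇐ A B C
    ; σ              = λ {A} {B} → σ A B
    ; λ-isoˡ         = identityˡ
    ; λ-isoʳ         = identityˡ
    ; ρ-isoˡ         = λ {A} → coe-invˡ (++-identityʳ A)
    ; ρ-isoʳ         = λ {A} → coe-invʳ (++-identityʳ A)
    ; α-isoˡ         = λ {A} {B} {C} → coe-invˡ (++-assoc A B C)
    ; α-isoʳ         = λ {A} {B} {C} → coe-invʳ (++-assoc A B C)
    ; σ-iso          = λ {A} {B} → σ-iso {B} {A}
    ; λ-natural      = ≈-trans identityˡ (≈-trans ⊗-unitˡ (≈-sym identityʳ))
    ; ρ-natural      = ⊗-unitʳ
    ; α-natural      = ⊗-assoc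
    ; σ-natural      = σ-natural
    ; triangle       = λ {A} {B} → isCoe-unique
        (∘-isCoe (⊗-isCoe id-isCoe id-isCoe) (coe-isCoe (++-assoc A [] B)))
        (⊗-isCoe (coe-isCoe (++-identityʳ A)) id-isCoe)
    ; pentagon       = λ {A} {B} {C} {D} → isCoe-unique
        (∘-isCoe (⊗-isCoe id-isCoe (coe-isCoe (++-assoc B C D)))
          (∘-isCoe (coe-isCoe (++-assoc A (B ++ C) D))
            (⊗-isCoe (coe-isCoe (++-assoc A B C)) id-isCoe)))
        (∘-isCoe (coe-isCoe (++-assoc A B (C ++ D))) (coe-isCoe (++-assoc (A ++ B) C D)))
    ; hexagon        = λ {A} {B} {C} → σ-hexagon {B} {A} {C}
    }

  category : MarkovCategory 0ℓ 0ℓ 0ℓ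
  category = record
    { symmetricMonoidal = symmetricMonoidal
    ; copy              = λ {A} → copy A
    ; discard           = λ {A} → discard A
    ; discard-unique    = discard-unique
    ; copy-counitˡ      = ≈-trans identityˡ copy-counitˡ
    ; copy-counitʳ      = copy-counitʳ
    ; copy-assoc        = copy-assoc
    ; copy-comm         = copy-comm
    ; copy-unit         = ≈-trans (discard-unique (copy [])) (≈-sym (discard-unique id))
    ; copy-⊗            = λ {A} {B} → copy-⊗ {A} {B}
    }

------------------------------------------------------------------------
-- Network diagrams

module Network (G : OpenDAG) where
  open OpenDAG G
  open Free G

  private
    variable
      A B C D : List Vertex

  boxes : Diagram A B → List Vertex
  boxes id          = []
  boxes (g ∘ f)     = boxes f ++ boxes g
  boxes (f ⊗ g)     = boxes f ++ boxes g
  boxes (σ A B)     = []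
  boxes (copy A)    = []
  boxes (discard A) = []
  boxes (c X _)     = [ X ]

  -- A wire is labelled by the variable that is its type.  Every class of wires
  -- connected by copy maps has a unique source, either an input of the diagram
  -- or the output of a box, so A ++ boxes d lists the labels of these classes.
  record IsNetwork (d : Diagram A B) : Set where
    field
      distinct-wires     : Unique (A ++ boxes d)
      distinct-outputs   : Unique B
      distinct-boxInputs : All (λ X → Unique (Pa X)) (boxes d)

  -- In a network diagram labels identify wires up to copying, so a path in the
  -- diagram starting from the output of a box is a path of G through its boxes.
  IsNormalised : Diagram A B → Set
  IsNormalised {B = B} d = ∀ {X} → X ∈ boxes d → ∃[ Y ] (Y ∈ B × Path (_∈ boxes d) X Y)

  -- A morphism is a diagram up to _≈_, so being one of these is a property of
  -- some representative.
  IsNetworkDiagram : Diagram A B → Set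
  IsNetworkDiagram {A} {B} f = Σ[ d ∈ Diagram A B ] (d ≈ f × IsNetwork d)

  IsNormalisedNetworkDiagram : Diagram A B → Set
  IsNormalisedNetworkDiagram {A} {B} f = Σ[ d ∈ Diagram A B ] (d ≈ f × IsNetwork d × IsNormalised d)

  project : ∀ {X} → X ∈ A → Diagram A [ X ]
  project {X = X} (here {xs = A} refl) = id {[ X ]} ⊗ discard A
  project (there {x = Y} i)            = discard [ Y ] ⊗ project i

  wire : ∀ B → B ⊆ A → Diagram A B
  wire {A} []      s = discard A
  wire {A} (X ∷ B) s = (project (s (here refl)) ⊗ wire B (λ i → s (there i))) ∘ copy A

  -- Topological A R: from the wires A, the boxes R can be applied in this order.
  data Topological (A : List Vertex) : List Vertex → Set where
    []  : Topological A []
    add : ∀ {X R} → X ∉ˢ inputs → Pa X ⊆ A → Topological (X ∷ A) R → Topological A (X ∷ R)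

  assemble : ∀ {R} → Topological A R → Diagram A (R ʳ++ A)
  assemble         []               = id
  assemble {A = A} (add {X} X∉in pa t) =
    assemble t ∘ ((c X X∉in ∘ wire (Pa X) pa) ⊗ id {A}) ∘ copy A

  private
    ⟶⁺-isStrictPartialOrder : IsStrictPartialOrder _≡_ (TransClosure _⟶_)
    ⟶⁺-isStrictPartialOrder = record
      { isEquivalence = isEquivalence
      ; irrefl        = λ { refl → acyclic }
      ; trans         = _++⁺_
      ; <-resp-≈      = resp₂ (TransClosure _⟶_)
      }

  reaches? : ∀ S X → Dec (Reaches S X)
  reaches? S X₀ = go X₀ (spo-noetherian ⟶⁺-isStrictPartialOrder X₀)
    where
    fold : ∀ {X} → X ∈ˢ S ⊎ (∃[ Y ] (X ⟶ Y × Reaches S Y)) → Reaches S X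
    fold {X} (inj₁ X∈S)                = X , X∈S , stop _
    fold (inj₂ (Y , X⟶Y , Z , Z∈S , p)) = Z , Z∈S , step _ X⟶Y p

    unfold : ∀ {X} → Reaches S X → X ∈ˢ S ⊎ (∃[ Y ] (X ⟶ Y × Reaches S Y))
    unfold (_ , X∈S , stop _)         = inj₁ X∈S
    unfold (Z , Z∈S , step _ X⟶Y p) = inj₂ (_ , X⟶Y , Z , Z∈S , p)

    go : ∀ X → Acc (flip (TransClosure _⟶_)) X → Dec (Reaches S X)
    go X (acc rec) = map′ fold unfold (X ∈ˢ? S ⊎-dec any? step?)
      where
      step? : ∀ Y → Dec (X ⟶ Y × Reaches S Y)
      step? Y with X ⟶? Y
      ... | no ¬X⟶Y = no (λ p → ¬X⟶Y (proj₁ p))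
      ... | yes X⟶Y = map′ (X⟶Y ,_) proj₂ (go Y (rec [ X⟶Y ]⁺))

  private
    minimal : ∀ R {X} → X ∈ R → ∃[ Y ] (Y ∈ R × (∀ {Z} → Z ∈ R → ¬ (Z ⟶ Y)))
    minimal R {X₀} X₀∈R = go X₀ X₀∈R (spo-wellFounded ⟶⁺-isStrictPartialOrder X₀)
      where
      go : ∀ X → X ∈ R → Acc (TransClosure _⟶_) X → ∃[ Y ] (Y ∈ R × (∀ {Z} → Z ∈ R → ¬ (Z ⟶ Y)))
      go X X∈R (acc rec) with any? (λ Z → anyˡ? (Z ≟_) R ×-dec Z ⟶? X)
      ... | yes (Z , Z∈R , Z⟶X) = go Z Z∈R (rec [ Z⟶X ]⁺)
      ... | no  none            = X , X∈R , λ Z∈R Z⟶X → none (_ , Z∈R , Z⟶X)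

  topologicalSort : ∀ A R → (∀ {X} → X ∈ R → X ∉ˢ inputs) →
                    (∀ {X Y} → Y ∈ R → X ⟶ Y → X ∈ R ⊎ X ∈ A) →
                    ∃[ R′ ] (R ↭ R′ × Topological A R′)
  topologicalSort A₀ R₀ = go (length R₀) A₀ R₀ refl
    where
    go : ∀ k A R → length R ≡ k → (∀ {X} → X ∈ R → X ∉ˢ inputs) →
         (∀ {X Y} → Y ∈ R → X ⟶ Y → X ∈ R ⊎ X ∈ A) →
         ∃[ R′ ] (R ↭ R′ × Topological A R′)
    go ℕ.zero    A []       _   nin closed = [] , ↭-refl , []
    go (ℕ.suc k) A (X₀ ∷ R) len nin closed
      with X , X∈ , min ← minimal (X₀ ∷ R) (here refl)
      with ys , zs , eq ← ∈-∃++ X∈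
      = X ∷ proj₁ rest , ↭-trans perm (↭-prep X (proj₁ (proj₂ rest))) , add (nin X∈) pa⊆A (proj₂ (proj₂ rest))
      where
      perm : X₀ ∷ R ↭ X ∷ ys ++ zs
      perm = ↭-trans (↭-reflexive eq) (shift X ys zs)

      closed′ : ∀ {Z Y} → Y ∈ ys ++ zs → Z ⟶ Y → Z ∈ ys ++ zs ⊎ Z ∈ X ∷ A
      closed′ i Z⟶Y with closed (∈-resp-↭ (↭-sym perm) (there i)) Z⟶Y
      ... | inj₂ Z∈A = inj₂ (there Z∈A)
      ... | inj₁ Z∈R with ∈-resp-↭ perm Z∈R
      ...   | here Z≡X = inj₂ (here Z≡X)
      ...   | there j  = inj₁ j

      rest : ∃[ R′ ] (ys ++ zs ↭ R′ × Topological (X ∷ A) R′)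
      rest = go k (X ∷ A) (ys ++ zs) (suc-injective (trans (sym (↭-length perm)) len))
                (λ i → nin (∈-resp-↭ (↭-sym perm) (there i))) closed′

      pa⊆A : Pa X ⊆ A
      pa⊆A Z∈Pa with Z⟶X ← proj₂ (∈-filter⁻ (_⟶? X) {xs = allFin size} Z∈Pa) with closed X∈ Z⟶X
      ... | inj₁ Z∈R = contradiction Z⟶X (min Z∈R)
      ... | inj₂ Z∈A = Z∈A

  IsActive : Subset size → Pred Vertex 0ℓ
  IsActive S X = X ∉ˢ inputs × Reaches S X

  isActive? : ∀ S X → Dec (IsActive S X)
  isActive? S X = ¬? (X ∈ˢ? inputs) ×-dec reaches? S X

  activeBoxes : Subset size → List Vertex
  activeBoxes S = filter (isActive? S) (allFin size)

  sortedBoxes : ∀ S → ∃[ R ] (activeBoxes S ↭ R × Topological (elements inputs) R)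
  sortedBoxes S = topologicalSort (elements inputs) (activeBoxes S) (λ i → proj₁ (active⁻ i)) closed
    where
    active⁻ : ∀ {X} → X ∈ activeBoxes S → IsActive S X
    active⁻ i = proj₂ (∈-filter⁻ (isActive? S) {xs = allFin size} i)

    closed : ∀ {X Y} → Y ∈ activeBoxes S → X ⟶ Y → X ∈ activeBoxes S ⊎ X ∈ elements inputs
    closed {X} Y∈ X⟶Y with X ∈ˢ? inputs | active⁻ Y∈
    ... | yes X∈in | _                = inj₂ (∈-filter⁺ (_∈ˢ? inputs) (∈-allFin X) X∈in)
    ... | no  X∉in | _ , Z , Z∈S , path =
      inj₁ (∈-filter⁺ (isActive? S) (∈-allFin X) (X∉in , Z , Z∈S , step _ X⟶Y path))

  outputs⊆wires : ∀ {R} S → activeBoxes S ↭ R → elements S ⊆ R ʳ++ elements inputs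
  outputs⊆wires {R} S perm {X} X∈ with X ∈ˢ? inputs | proj₂ (∈-filter⁻ (_∈ˢ? S) {xs = allFin size} X∈)
  ... | yes X∈in | _   = reverseAcc⁺ _ R (inj₁ (∈-filter⁺ (_∈ˢ? inputs) (∈-allFin X) X∈in))
  ... | no  X∉in | X∈S = reverseAcc⁺ _ R
    (inj₂ (∈-resp-↭ perm (∈-filter⁺ (isActive? S) (∈-allFin X) (X∉in , X , X∈S , stop _))))

  -- The network diagram with outputs S.  All available wires are copied at each
  -- step and superfluous copies are discarded at the end; by the counit laws this
  -- is the diagram in which only the copies that are used are made.
  networkDiagram : ∀ S → Diagram (elements inputs) (elements S)
  networkDiagram S with R , perm , t ← sortedBoxes S = wire (elements S) (outputs⊆wires S perm) ∘ assemble t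

  boxes-project : ∀ {X} (i : X ∈ A) → boxes (project i) ≡ []
  boxes-project (here refl) = refl
  boxes-project (there i)   = boxes-project i

  boxes-wire : ∀ B (s : B ⊆ A) → boxes (wire B s) ≡ []
  boxes-wire []      s = refl
  boxes-wire (X ∷ B) s
    rewrite boxes-project (s (here refl)) | boxes-wire B (λ i → s (there i)) = refl

  boxes-assemble : ∀ {R} (t : Topological A R) → boxes (assemble t) ≡ R
  boxes-assemble []              = refl
  boxes-assemble (add {X} _ s t) rewrite boxes-wire (Pa X) s | boxes-assemble t = refl

  networkDiagram-boxes : ∀ S → boxes (networkDiagram S) ↭ activeBoxes S
  networkDiagram-boxes S with R , perm , t ← sortedBoxes S
    rewrite boxes-assemble t | boxes-wire (elements S) (outputs⊆wires S perm) | ++-identityʳ R = ↭-sym perm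

------------------------------------------------------------------------
-- Structural well-behavedness

module _ {m n : ℕ} (π : Fin m → List (Fin n)) (S : Subset m) where

  image : List (Fin n)
  image = concatMap π (elements S)

  ImageWithin : Subset n → Set
  ImageWithin T = Unique image × All (_∈ˢ T) image

  ImageEquals : Subset n → Set
  ImageEquals T = ImageWithin T × (∀ {Z} → Z ∈ˢ T → Z ∈ image)

module _ {o ℓ e : Level} {𝒞 : MarkovCategory o ℓ e} (K : CausalModel 𝒞) where
  open CausalModel K

  𝐒 : MarkovCategory 0ℓ 0ℓ 0ℓ
  𝐒 = Free.category dag

  D : Free.Diagram dag (elements inputs) (elements outputs)
  D = Network.networkDiagram dag outputs

module Abstraction {o ℓ e : Level} {𝒞 : MarkovCategory o ℓ e} (L H : CausalModel 𝒞) where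
  private
    module L = CausalModel L
    module H = CausalModel H

  open Network L.dag using (IsNormalisedNetworkDiagram)

  module _ (πₛ : CDFunctor (𝐒 H) (𝐒 L)) where
    open CDFunctor πₛ

    π : H.Vertex → List L.Vertex
    π X = F₀ [ X ]

    M : H.Vertex → Pred L.Vertex 0ℓ
    M X Z = ∃[ W ] (W ∈ π X × L.Path (_∉ concatMap π (H.Pa X)) Z W)

    record StructurallyWellBehaved : Set where
      field
        normalised-mechanisms : ∀ X (X∉in : X ∉ˢ H.inputs) →
                                IsNormalisedNetworkDiagram (F₁ (Free.c X X∉in))
        no-repetitions        : ∀ X → Unique (π X)
        disjoint              : ∀ {X Y} → X ≢ Y → Disjoint (π X) (π Y)
        inputs-equal          : ImageEquals π H.inputs L.inputs
        outputs-within        : ImageWithin π H.outputs L.outputs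
        M-disjoint            : ∀ {X Y} → X ≢ Y → ∀ {Z} → ¬ (M X Z × M Y Z)

{-# OPTIONS --safe #-}
module Submission where

-- The boxes that the outputs of a diagram depend on are an invariant of the morphism.
-- To see this, interpret diagrams as relations between lists of sets of names, where a
-- box X outputs an arbitrarily chosen name labelled X together with all the names it
-- receives. A diagram then outputs at most one new name per box, whereas a diagram in
-- which every box has a path to an output can output distinct names for all its boxes.
-- Every diagram is equal to one of the latter kind, by deleting what is discarded; in
-- particular isomorphisms have representatives without boxes, so that F₀ A is, up to
-- wiring, the concatenation of the lists π X for X in A.
--
-- If the mechanisms of H are sent to normalised network diagrams, then the boxes of
-- the image of c_X lie in M X, so disjointness of the sets M X makes all boxes of the
-- image of D_H distinct. Conversely, since every mechanism of H ends in an output, the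
-- names of all boxes of the normal forms of the images of the c_X survive in the image of
-- D_H; if the latter is a network diagram, these boxes are therefore distinct. A path
-- into π X that avoids π (Pa X) can only run through boxes of the image of c_X, so M X
-- consists of such boxes, which gives the disjointness of the sets M X.

open import Level using (0ℓ; _⊔_)
open import Defs
open import Data.Fin.Base using (toℕ)
open import Data.Fin.Induction using (spo-wellFounded)
open import Data.Fin.Properties using (_≟_; toℕ-injective)
open import Data.Fin.Subset using (_⊆_; Subset) renaming (_∉_ to _∉ˢ_; _∈_ to _∈ˢ_)
open import Data.Fin.Subset.Properties using (x∈∁p⇒x∉p; x∉p⇒x∈∁p) renaming (_∈?_ to _∈ˢ?_)
open import Data.Bool.Base using (if_then_else_)
open import Data.List.Base using (List; []; _∷_; [_]; _++_; map; concat; concatMap; length; upTo; allFin)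
open import Data.List.Properties using (map-++; ++-assoc; ++-identityʳ; ∷-injective; ++-conicalˡ; ++-conicalʳ; length-upTo; length-map; map-cong-local; concatMap-++)
open import Data.List.Membership.Propositional using (_∈_; _∉_; find; lose)
open import Data.List.Membership.Propositional.Properties using (∈-++⁺ˡ; ∈-++⁺ʳ; ∈-++⁻; ∈-filter⁺; ∈-filter⁻; ∈-allFin; ∈-map⁺; ∈-map⁻)
open import Data.List.Relation.Unary.Any using (Any; here; there)
open import Data.List.Relation.Unary.Any.Properties using (concat⁺; concat⁻; concatMap⁺; concatMap⁻) renaming (++⁺ˡ to Any-++⁺ˡ; ++⁺ʳ to Any-++⁺ʳ; ++⁻ to Any-++⁻)
import Data.List.Relation.Unary.All as All
open import Data.List.Relation.Unary.AllPairs using ([]; _∷_)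
open import Data.List.Relation.Unary.Unique.Propositional using (Unique)
open import Data.List.Relation.Unary.Unique.Propositional.Properties using (upTo⁺; map⁺; map⁻; ++⁺; filter⁺; allFin⁺)
open import Data.List.Relation.Binary.Disjoint.Propositional using (Disjoint)
open import Data.List.Relation.Binary.Permutation.Propositional using (↭-sym; ↭⇒↭ₛ)
open import Data.List.Relation.Binary.Permutation.Setoid.Properties using (Unique-resp-↭)
open import Data.List.Relation.Binary.Sublist.Propositional using ([]; _∷_; _∷ʳ_) renaming (_⊆_ to _⊑_)
open import Data.Nat.Base using (ℕ)
open import Data.Nat.Properties using (suc-injective)
open import Data.Product using (_×_; _,_; ∃; ∃-syntax; Σ-syntax; proj₁; proj₂; swap)
open import Data.Sum.Base as Sum using (_⊎_; inj₁; inj₂; [_,_]′)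
open import Data.Unit.Base using (⊤; tt)
open import Function.Base using (_∘′_)
open import Function.Bundles using (_⇔_; mk⇔)
open import Induction.WellFounded using (WellFounded; module FixPoint) renaming (module All to WfAll)
open import Relation.Binary.Bundles using (Setoid)
open import Relation.Binary.Construct.Closure.Transitive using (TransClosure) renaming ([_] to [_]⁺; _++_ to _++⁺_)
open import Relation.Binary.PropositionalEquality using (_≡_; _≢_; refl; sym; trans; cong; cong₂; subst; setoid; isEquivalence; resp₂)
import Relation.Binary.Reasoning.Setoid as SetoidReasoning
open import Relation.Nullary using (¬_; Dec; yes; no; does; contradiction)
open import Relation.Nullary.Decidable using (dec-true; dec-false)

-- Wirings and the relational semantics of diagrams

module _ {a b} {A : Set a} {B : Set b} where

  infix 4 _≍_
  -- Only lengths are compared: `x ≍ A` says that the values `x` fit the wires `A`. With the arity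
  -- as a proposition, lists of values stay untyped and reassociating wires does not transport them.
  data _≍_ : List A → List B → Set (a ⊔ b) where
    []  : [] ≍ []
    _∷_ : ∀ x y {xs ys} → xs ≍ ys → x ∷ xs ≍ y ∷ ys

  ≍-split : ∀ ys zs {xs} → xs ≍ ys ++ zs → ∃[ us ] ∃[ vs ] (xs ≡ us ++ vs × us ≍ ys × vs ≍ zs)
  ≍-split []       zs l = [] , _ , refl , [] , l
  ≍-split (y ∷ ys) zs ((x ∷ .y) l) with us , vs , refl , p , q ← ≍-split ys zs l =
    x ∷ us , vs , refl , (x ∷ y) p , q

  ≍-split₃ : ∀ ys zs ws {xs} → xs ≍ ys ++ zs ++ ws →
             ∃[ us ] ∃[ vs ] ∃[ rs ] (xs ≡ us ++ vs ++ rs × us ≍ ys × vs ≍ zs × rs ≍ ws)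
  ≍-split₃ ys zs ws l with us , _ , refl , p , l′ ← ≍-split ys (zs ++ ws) l
    with vs , rs , refl , q , r ← ≍-split zs ws l′ = us , vs , rs , refl , p , q , r

  ≍-++ : ∀ {us vs ys zs} → us ≍ ys → vs ≍ zs → us ++ vs ≍ ys ++ zs
  ≍-++ []          q = q
  ≍-++ ((x ∷ y) p) q = (x ∷ y) (≍-++ p q)

  ≍-length : ∀ xs ys → length xs ≡ length ys → xs ≍ ys
  ≍-length []       []       _  = []
  ≍-length (x ∷ xs) (y ∷ ys) eq = (x ∷ y) (≍-length xs ys (suc-injective eq))

  ≍-map : ∀ (f : B → A) ys → map f ys ≍ ys
  ≍-map f []       = []
  ≍-map f (y ∷ ys) = (f y ∷ y) (≍-map f ys)

  ≍-zip : ∀ {xs ys} → xs ≍ ys → ∃[ zs ] (map proj₁ zs ≡ ys × map proj₂ zs ≡ xs)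
  ≍-zip []          = [] , refl , refl
  ≍-zip ((x ∷ y) l) with zs , refl , refl ← ≍-zip l = (y , x) ∷ zs , refl , refl

  -- Both prefixes have the length of `ys`, which fixes the place of the split.
  ++-injective : ∀ {us us′ vs vs′ ys} → us ≍ ys → us′ ≍ ys → us ++ vs ≡ us′ ++ vs′ → us ≡ us′ × vs ≡ vs′
  ++-injective []          []           eq = refl , eq
  ++-injective ((x ∷ _) p) ((x′ ∷ _) q) eq with refl , eq′ ← ∷-injective eq
    with refl , refl ← ++-injective p q eq′ = refl , refl

module Wirings (G : OpenDAG) where
  open OpenDAG G
  open Free G
  open Network G

  private
    variable
      A B C E : List Vertex

  -- Amounts to `boxes d ≡ []` by the lemmas below, but can be matched on without taking apart an
  -- equation between concatenations.
  data Wiring : Diagram A B → Set where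
    id      : Wiring (id {A})
    _∘_     : {g : Diagram B C} {f : Diagram A B} → Wiring g → Wiring f → Wiring (g ∘ f)
    _⊗_     : {f : Diagram A B} {g : Diagram C E} → Wiring f → Wiring g → Wiring (f ⊗ g)
    σ       : ∀ A B → Wiring (σ A B)
    copy    : ∀ A → Wiring (copy A)
    discard : ∀ A → Wiring (discard A)

  coe-wiring : (p : A ≡ B) → Wiring (coe p)
  coe-wiring refl = id

  boxes-wiring : {d : Diagram A B} → Wiring d → boxes d ≡ []
  boxes-wiring id          = refl
  boxes-wiring (w ∘ w′)    rewrite boxes-wiring w′ = boxes-wiring w
  boxes-wiring (w ⊗ w′)    rewrite boxes-wiring w = boxes-wiring w′
  boxes-wiring (σ A B)     = refl
  boxes-wiring (copy A)    = refl
  boxes-wiring (discard A) = refl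

  boxless⇒wiring : (d : Diagram A B) → boxes d ≡ [] → Wiring d
  boxless⇒wiring id          _  = id
  boxless⇒wiring (g ∘ f)     eq = boxless⇒wiring g (++-conicalʳ (boxes f) _ eq) ∘ boxless⇒wiring f (++-conicalˡ _ _ eq)
  boxless⇒wiring (f ⊗ g)     eq = boxless⇒wiring f (++-conicalˡ _ _ eq) ⊗ boxless⇒wiring g (++-conicalʳ (boxes f) _ eq)
  boxless⇒wiring (σ A B)     _  = σ A B
  boxless⇒wiring (copy A)    _  = copy A
  boxless⇒wiring (discard A) _  = discard A

-- `γ X x v` says that the box `X` may output `v` on the inputs `x`. Having a choice separates two
-- uses of a box from one use whose output is copied; `γ-total` is what makes `discard-unique` hold.
module Semantics (G : OpenDAG) {V : Set} (γ : OpenDAG.Vertex G → List V → V → Set)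
                 (γ-total : ∀ X x → ∃ (γ X x)) where
  open OpenDAG G
  open Free G
  open Network G
  open Wirings G using (Wiring; id; _∘_; _⊗_; σ; copy; discard; coe-wiring)

  private
    variable
      A B C E : List Vertex
      x y z : List V

  -- Every generator demands that its input fits its domain. This gives `dom` and `cod`, and with
  -- them the uniqueness of the splittings in the case of `⊗`.
  ⟦_⟧ : Diagram A B → List V → List V → Set
  ⟦ id {A} ⟧    x y = x ≍ A × x ≡ y
  ⟦ g ∘ f ⟧     x z = ∃[ y ] (⟦ f ⟧ x y × ⟦ g ⟧ y z)
  ⟦ f ⊗ g ⟧     x y = ∃[ x₁ ] ∃[ x₂ ] ∃[ y₁ ] ∃[ y₂ ]
                      (x ≡ x₁ ++ x₂ × y ≡ y₁ ++ y₂ × ⟦ f ⟧ x₁ y₁ × ⟦ g ⟧ x₂ y₂)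
  ⟦ σ A B ⟧     x y = ∃[ x₁ ] ∃[ x₂ ]
                      (x ≡ x₁ ++ x₂ × y ≡ x₂ ++ x₁ × x₁ ≍ A × x₂ ≍ B)
  ⟦ copy A ⟧    x y = x ≍ A × y ≡ x ++ x
  ⟦ discard A ⟧ x y = x ≍ A × y ≡ []
  ⟦ c X _ ⟧     x y = x ≍ Pa X × ∃[ v ] (y ≡ [ v ] × γ X x v)

  _⊠_ : ∀ {f : Diagram A B} {g : Diagram C E} {x₁ x₂ y₁ y₂} →
        ⟦ f ⟧ x₁ y₁ → ⟦ g ⟧ x₂ y₂ → ⟦ f ⊗ g ⟧ (x₁ ++ x₂) (y₁ ++ y₂)
  p ⊠ q = _ , _ , _ , _ , refl , refl , p , q

  dom : (d : Diagram A B) → ⟦ d ⟧ x y → x ≍ A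
  dom id          (l , _)                                  = l
  dom (g ∘ f)     (_ , p , _)                              = dom f p
  dom (_⊗_ {A} f g) (_ , _ , _ , _ , refl , _ , p , q)     = ≍-++ (dom f p) (dom g q)
  dom (σ A B)     (_ , _ , refl , _ , l , l′)              = ≍-++ l l′
  dom (copy A)    (l , _)                                  = l
  dom (discard A) (l , _)                                  = l
  dom (c X _)     (l , _)                                  = l

  cod : (d : Diagram A B) → ⟦ d ⟧ x y → y ≍ B
  cod id          (l , refl)                               = l
  cod (g ∘ f)     (_ , _ , q)                              = cod g q
  cod (_⊗_ {B = B} f g) (_ , _ , _ , _ , _ , refl , p , q) = ≍-++ (cod f p) (cod g q)
  cod (σ A B)     (_ , _ , _ , refl , l , l′)              = ≍-++ l′ l
  cod (copy A)    (l , refl)                               = ≍-++ l l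
  cod (discard A) (_ , refl)                               = []
  cod (c X _)     (_ , _ , refl , _)                       = (_ ∷ _) []

  total : (d : Diagram A B) → x ≍ A → ∃ (⟦ d ⟧ x)
  total id          l = _ , l , refl
  total (g ∘ f)     l with y , p ← total f l with z , q ← total g (cod f p) = z , y , p , q
  total {x = x} (_⊗_ {A} {C = C} f g) l with x₁ , x₂ , refl , l₁ , l₂ ← ≍-split A C l
    with _ , p ← total f l₁ with _ , q ← total g l₂ = _ , _⊠_ {f = f} {g = g} p q
  total {x = x} (σ A B) l with x₁ , x₂ , refl , l₁ , l₂ ← ≍-split A B l =
    _ , _ , _ , refl , refl , l₁ , l₂
  total (copy A)    l = _ , l , refl
  total (discard A) l = _ , l , refl
  total {x = x} (c X _) l with v , p ← γ-total X x = _ , l , v , refl , p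

  -- Choice enters only through `γ`. In the case of `⊗` both derivations split the input at the same
  -- place, as both left halves fit the same wires.
  wiring-deterministic : {d : Diagram A B} → Wiring d → ⟦ d ⟧ x y → ⟦ d ⟧ x z → y ≡ z
  wiring-deterministic id (_ , refl) (_ , refl) = refl
  wiring-deterministic {d = g ∘ f} (w ∘ w′) (_ , p , q) (_ , p′ , q′)
    with refl ← wiring-deterministic w′ p p′ = wiring-deterministic w q q′
  wiring-deterministic {d = f ⊗ g} (w ⊗ w′)
    (x₁ , _ , _ , _ , refl , refl , p , q) (x₁′ , _ , _ , _ , eq , refl , p′ , q′)
    with refl , refl ← ++-injective (dom f p) (dom f p′) eq =
    cong₂ _++_ (wiring-deterministic w p p′) (wiring-deterministic w′ q q′)
  wiring-deterministic (σ A B) (x₁ , _ , refl , refl , l , _) (x₁′ , _ , eq , refl , l′ , _)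
    with refl , refl ← ++-injective l l′ eq = refl
  wiring-deterministic (copy A) (_ , refl) (_ , refl) = refl
  wiring-deterministic (discard A) (_ , refl) (_ , refl) = refl

  wiring-map : {d : Diagram A B} → Wiring d → (v : Vertex → V) → ⟦ d ⟧ (map v A) (map v B)
  wiring-map (id {A}) v = ≍-map v A , refl
  wiring-map (w ∘ w′) v = _ , wiring-map w′ v , wiring-map w v
  wiring-map (_⊗_ {A} {B} {C} {E} w w′) v =
    _ , _ , _ , _ , map-++ v A C , map-++ v B E , wiring-map w v , wiring-map w′ v
  wiring-map (σ A B) v = _ , _ , map-++ v A B , map-++ v B A , ≍-map v A , ≍-map v B
  wiring-map (copy A) v = ≍-map v A , map-++ v A A
  wiring-map (discard A) v = ≍-map v A , refl

  coe⁺ : (p : A ≡ B) → x ≍ A → ⟦ coe p ⟧ x x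
  coe⁺ refl l = l , refl

  coe⁻ : (p : A ≡ B) → ⟦ coe p ⟧ x y → x ≡ y
  coe⁻ refl (_ , eq) = eq

  infix 4 _≃_
  _≃_ : Diagram A B → Diagram A B → Set
  f ≃ g = ∀ {x y} → (⟦ f ⟧ x y → ⟦ g ⟧ x y) × (⟦ g ⟧ x y → ⟦ f ⟧ x y)

  -- Both relations are single-valued, so one common output for each input makes them equal. Axioms
  -- between wirings thereby reduce to computing one output.
  wiring-≃ : {f g : Diagram A B} → Wiring f → Wiring g →
             (∀ x → x ≍ A → ∃[ y ] (⟦ f ⟧ x y × ⟦ g ⟧ x y)) → f ≃ g
  wiring-≃ {f = f} {g} v w common {x} = to , from
    where
    to : ∀ {y} → ⟦ f ⟧ x y → ⟦ g ⟧ x y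
    to p with _ , q , r ← common x (dom f p) = subst (⟦ g ⟧ x) (wiring-deterministic v q p) r
    from : ∀ {y} → ⟦ g ⟧ x y → ⟦ f ⟧ x y
    from p with _ , q , r ← common x (dom g p) = subst (⟦ f ⟧ x) (wiring-deterministic w r p) q

  coeʳ : (p : A ≡ B) → x ≍ A → x ≡ y → ⟦ coe p ⟧ x y
  coeʳ p l refl = coe⁺ p l

  open Free._≈_

  -- Axioms between wirings hold by computing a common output, naturality axioms by splitting lists
  -- at equal lengths, and `discard-unique` because every relation is total and only `[]` fits no
  -- wires.
  sound : {f g : Diagram A B} → f ≈ g → f ≃ g
  sound ≈-refl = (λ p → p) , λ p → p
  sound (≈-sym e) = swap (sound e)
  sound (≈-trans e e′) = (λ p → proj₁ (sound e′) (proj₁ (sound e) p)) , λ p → proj₂ (sound e) (proj₂ (sound e′) p)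
  sound (∘-resp-≈ e e′) =
    (λ (y , p , q) → y , proj₁ (sound e′) p , proj₁ (sound e) q) ,
    (λ (y , p , q) → y , proj₂ (sound e′) p , proj₂ (sound e) q)
  sound (⊗-resp-≈ e e′) =
    (λ (_ , _ , _ , _ , eq , eq′ , p , q) → _ , _ , _ , _ , eq , eq′ , proj₁ (sound e) p , proj₁ (sound e′) q) ,
    (λ (_ , _ , _ , _ , eq , eq′ , p , q) → _ , _ , _ , _ , eq , eq′ , proj₂ (sound e) p , proj₂ (sound e′) q)
  sound assoc =
    (λ (_ , p , _ , q , r) → _ , (_ , p , q) , r) , (λ (_ , (_ , p , q) , r) → _ , p , _ , q , r)
  sound (identityˡ {f = f}) = (λ { (_ , p , _ , refl) → p }) , (λ p → _ , p , cod f p , refl)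
  sound (identityʳ {f = f}) = (λ { (_ , (_ , refl) , p) → p }) , (λ p → _ , (dom f p , refl) , p)
  sound (⊗-identity {A} {B}) = wiring-≃ (id ⊗ id) id common
    where
    common : ∀ x → x ≍ (A ++ B) → ∃[ y ] (⟦ id {A} ⊗ id {B} ⟧ x y × ⟦ id {A ++ B} ⟧ x y)
    common x l with x₁ , x₂ , refl , l₁ , l₂ ← ≍-split A B l =
      _ , (_ , _ , _ , _ , refl , refl , (l₁ , refl) , (l₂ , refl)) , l , refl
  sound (⊗-homomorphism {f = f} {g} {f′} {g′}) =
    (λ (_ , _ , _ , _ , eq , eq′ , (_ , p , q) , (_ , p′ , q′)) →
       _ , (_ , _ , _ , _ , eq , refl , p , p′) , (_ , _ , _ , _ , refl , eq′ , q , q′)) ,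
    from
    where
    from : ∀ {x y} → ⟦ (g ⊗ g′) ∘ (f ⊗ f′) ⟧ x y → ⟦ (g ∘ f) ⊗ (g′ ∘ f′) ⟧ x y
    from (_ , (_ , _ , y₁ , _ , eq , refl , p , p′) , (z₁ , _ , _ , _ , eq′ , eq″ , q , q′))
      with refl , refl ← ++-injective (cod f p) (dom g q) eq′ =
      _ , _ , _ , _ , eq , eq″ , (_ , p , q) , (_ , p′ , q′)
  sound ⊗-unitˡ =
    (λ { ([] , _ , _ , _ , refl , refl , (_ , refl) , p) → p }) ,
    (λ p → [] , _ , [] , _ , refl , refl , ([] , refl) , p)
  sound (⊗-unitʳ {A = A} {B} {f = f}) = to , from
    where
    to : ∀ {x y} → ⟦ ρ⇒ B ∘ (f ⊗ id {[]}) ⟧ x y → ⟦ f ∘ ρ⇒ A ⟧ x y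
    to (_ , (x , [] , y , _ , refl , refl , p , (_ , refl)) , q)
      with refl ← coe⁻ (++-identityʳ B) q
      rewrite ++-identityʳ x | ++-identityʳ y =
      _ , coe⁺ (++-identityʳ A) (subst (_ ≍_) (sym (++-identityʳ A)) (dom f p)) , p
    from : ∀ {x y} → ⟦ f ∘ ρ⇒ A ⟧ x y → ⟦ ρ⇒ B ∘ (f ⊗ id {[]}) ⟧ x y
    from {x} {y} (_ , q , p) with refl ← coe⁻ (++-identityʳ A) q =
      y , (x , [] , y , [] , sym (++-identityʳ x) , sym (++-identityʳ y) , p , ([] , refl)) ,
      coe⁺ (++-identityʳ B) (subst (_ ≍_) (sym (++-identityʳ B)) (cod f p))
  sound (⊗-assoc {A} {A′} {B} {B′} {C} {C′} {f} {g} {h}) = to , from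
    where
    to : ∀ {x y} → ⟦ α⇒ A′ B′ C′ ∘ ((f ⊗ g) ⊗ h) ⟧ x y → ⟦ (f ⊗ (g ⊗ h)) ∘ α⇒ A B C ⟧ x y
    to (_ , r@(_ , _ , _ , _ , refl , refl , (a , b , a′ , b′ , refl , refl , p , q) , s) , e)
      with refl ← coe⁻ (++-assoc A′ B′ C′) e =
      _ , coe⁺ (++-assoc A B C) (dom ((f ⊗ g) ⊗ h) r) ,
      (_ , _ , _ , _ , ++-assoc a b _ , ++-assoc a′ b′ _ , p , _ , _ , _ , _ , refl , refl , q , s)
    from : ∀ {x y} → ⟦ (f ⊗ (g ⊗ h)) ∘ α⇒ A B C ⟧ x y → ⟦ α⇒ A′ B′ C′ ∘ ((f ⊗ g) ⊗ h) ⟧ x y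
    from (_ , e , r@(a , _ , a′ , _ , refl , refl , p , (b , _ , b′ , _ , refl , refl , q , s)))
      with refl ← coe⁻ (++-assoc A B C) e =
      _ , (_ , _ , _ , _ , sym (++-assoc a b _) , sym (++-assoc a′ b′ _) , (_ , _ , _ , _ , refl , refl , p , q) , s) ,
      coe⁺ (++-assoc A′ B′ C′) (subst (_ ≍_) (sym (++-assoc A′ B′ C′)) (cod (f ⊗ (g ⊗ h)) r))
  sound (σ-iso {A} {B}) = wiring-≃ (σ _ _ ∘ σ _ _) id common
    where
    common : ∀ x → x ≍ (B ++ A) → ∃[ y ] (⟦ σ A B ∘ σ B A ⟧ x y × ⟦ id {B ++ A} ⟧ x y)
    common x l with x₁ , x₂ , refl , l₁ , l₂ ← ≍-split B A l =
      _ , (_ , (_ , _ , refl , refl , l₁ , l₂) , (_ , _ , refl , refl , l₂ , l₁)) , l , refl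
  sound (σ-natural {A} {A′} {B} {B′} {f} {g}) = to , from
    where
    to : ∀ {x y} → ⟦ σ A′ B′ ∘ (f ⊗ g) ⟧ x y → ⟦ (g ⊗ f) ∘ σ A B ⟧ x y
    to (_ , (_ , _ , y₁ , _ , refl , refl , p , q) , (z₁ , _ , eq , refl , l , l′))
      with refl , refl ← ++-injective (cod f p) l eq =
      _ , (_ , _ , refl , refl , dom f p , dom g q) , (_ , _ , _ , _ , refl , refl , q , p)
    from : ∀ {x y} → ⟦ (g ⊗ f) ∘ σ A B ⟧ x y → ⟦ σ A′ B′ ∘ (f ⊗ g) ⟧ x y
    from (_ , (_ , z₂ , refl , refl , l , l′) , (y₁ , _ , _ , _ , eq , refl , q , p))
      with refl , refl ← ++-injective l′ (dom g q) eq =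
      _ , (_ , _ , _ , _ , refl , refl , p , q) , (_ , _ , refl , refl , cod f p , cod g q)
  sound (σ-hexagon {A} {B} {C}) =
    wiring-≃ ((id ⊗ σ _ _) ∘ (coe-wiring (++-assoc A B C) ∘ (σ _ _ ⊗ id)))
             (coe-wiring (++-assoc A C B) ∘ (σ _ _ ∘ coe-wiring (++-assoc B A C))) common
    where
    common : ∀ x → x ≍ ((B ++ A) ++ C) →
             ∃[ y ] (⟦ (id {A} ⊗ σ B C) ∘ α⇒ A B C ∘ (σ B A ⊗ id {C}) ⟧ x y ×
                     ⟦ α⇒ A C B ∘ σ B (A ++ C) ∘ α⇒ B A C ⟧ x y)
    common x l with b , a , r , refl , lb , la , lr ← ≍-split₃ B A C (subst (x ≍_) (++-assoc B A C) l) =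
      a ++ r ++ b ,
      (_ , (_ , (b ++ a , r , a ++ b , r , sym (++-assoc b a r) , refl , (b , a , refl , refl , lb , la) , (lr , refl)) ,
            coeʳ (++-assoc A B C) (≍-++ (≍-++ la lb) lr) (++-assoc a b r)) ,
       (a , b ++ r , a , r ++ b , refl , refl , (la , refl) , (b , r , refl , refl , lb , lr))) ,
      (_ , (_ , coe⁺ (++-assoc B A C) l ,
            (b , a ++ r , refl , refl , lb , ≍-++ la lr)) ,
       coeʳ (++-assoc A C B) (≍-++ (≍-++ la lr) lb) (++-assoc a r b))
  sound (discard-unique f) = to , from
    where
    to : ∀ {x y} → ⟦ f ⟧ x y → ⟦ discard _ ⟧ x y
    to {y = []} p = dom f p , refl
    to {y = _ ∷ _} p with () ← cod f p
    from : ∀ {x y} → ⟦ discard _ ⟧ x y → ⟦ f ⟧ x y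
    from (l , refl) with total f l
    ... | [] , p = p
    ... | _ ∷ _ , p with () ← cod f p
  sound copy-counitˡ = wiring-≃ ((discard _ ⊗ id) ∘ copy _) id
    λ x l → x , (_ , (l , refl) , (x , x , [] , x , refl , refl , (l , refl) , (l , refl))) , (l , refl)
  sound (copy-counitʳ {A}) = wiring-≃ (coe-wiring (++-identityʳ A) ∘ ((id ⊗ discard _) ∘ copy _)) id
    λ x l → x , (_ , (_ , (l , refl) , (x , x , x , [] , refl , refl , (l , refl) , (l , refl))) ,
                 coeʳ (++-identityʳ A) (≍-++ l []) (++-identityʳ x)) , (l , refl)
  sound (copy-assoc {A}) = wiring-≃ (coe-wiring (++-assoc A A A) ∘ ((copy _ ⊗ id) ∘ copy _)) ((id ⊗ copy _) ∘ copy _)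
    λ x l → x ++ x ++ x ,
      (_ , (_ , (l , refl) , (x , x , x ++ x , x , refl , refl , (l , refl) , (l , refl))) ,
       coeʳ (++-assoc A A A) (≍-++ (≍-++ l l) l) (++-assoc x x x)) ,
      (_ , (l , refl) , (x , x , x , x ++ x , refl , refl , (l , refl) , (l , refl)))
  sound copy-comm = wiring-≃ (σ _ _ ∘ copy _) (copy _)
    λ x l → x ++ x , (_ , (l , refl) , (x , x , refl , refl , l , l)) , (l , refl)
  sound (copy-⊗ {A} {B}) =
    wiring-≃ (copy _)
      (coe-wiring (sym (++-assoc A B (A ++ B))) ∘
       ((id ⊗ (coe-wiring (++-assoc B A B) ∘ ((σ _ _ ⊗ id) ∘ coe-wiring (sym (++-assoc A B B))))) ∘
        (coe-wiring (++-assoc A A (B ++ B)) ∘ (copy _ ⊗ copy _)))) common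
    where
    common : ∀ x → x ≍ (A ++ B) → ∃[ y ] (⟦ copy (A ++ B) ⟧ x y ×
      ⟦ α⇐ A B (A ++ B) ∘ (id {A} ⊗ (α⇒ B A B ∘ (σ A B ⊗ id {B}) ∘ α⇐ A B B))
        ∘ α⇒ A A (B ++ B) ∘ (copy A ⊗ copy B) ⟧ x y)
    common x l with a , b , refl , la , lb ← ≍-split A B l =
      _ , (l , refl) ,
      (_ , (a ++ a ++ b ++ b ,
            (_ , (a , b , a ++ a , b ++ b , refl , refl , (la , refl) , (lb , refl)) ,
             coeʳ (++-assoc A A (B ++ B)) (≍-++ (≍-++ la la) (≍-++ lb lb))
                  (++-assoc a a (b ++ b))) ,
            (a , a ++ b ++ b , a , b ++ a ++ b , refl , refl , (la , refl) ,
             (_ , (_ , coeʳ (sym (++-assoc A B B)) (≍-++ la (≍-++ lb lb)) (sym (++-assoc a b b)) ,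
                   (a ++ b , b , b ++ a , b , refl , refl , (a , b , refl , refl , la , lb) , (lb , refl))) ,
              coeʳ (++-assoc B A B) (≍-++ (≍-++ lb la) lb) (++-assoc b a b)))) ,
       coeʳ (sym (++-assoc A B (A ++ B))) (≍-++ la (≍-++ lb l)) (sym (++-assoc a b (a ++ b))))

-- Normal forms of diagrams

module Labels (G : OpenDAG) where
  open OpenDAG G
  open Free G
  open Network G

  private
    variable
      A B C E : List Vertex

  ∈-Pa⁻ : ∀ {X Y} → Y ∈ Pa X → Y ⟶ X
  ∈-Pa⁻ {X} i = proj₂ (∈-filter⁻ (_⟶? X) {xs = allFin size} i)

  -- A wire keeps its label from its source onwards, and the source is an input or a box of the same
  -- label.
  output-label : (d : Diagram A B) → ∀ {X} → X ∈ B → X ∈ A ⊎ X ∈ boxes d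
  output-label id i = inj₁ i
  output-label (g ∘ f) i with output-label g i
  ... | inj₂ j = inj₂ (∈-++⁺ʳ (boxes f) j)
  ... | inj₁ j = Sum.map₂ ∈-++⁺ˡ (output-label f j)
  output-label (_⊗_ {A} {B} f g) i with ∈-++⁻ B i
  ... | inj₁ j = Sum.map ∈-++⁺ˡ ∈-++⁺ˡ (output-label f j)
  ... | inj₂ j = Sum.map (∈-++⁺ʳ A) (∈-++⁺ʳ (boxes f)) (output-label g j)
  output-label (σ A B) i = inj₁ ([ ∈-++⁺ʳ A , ∈-++⁺ˡ ]′ (∈-++⁻ B i))
  output-label (copy A) i = inj₁ ([ (λ j → j) , (λ j → j) ]′ (∈-++⁻ A i))
  output-label (c X _) i = inj₂ i

  -- The input wires of a box `X` are labelled by `Pa X`; each is traced back to its source with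
  -- `output-label`.
  parent-label : (d : Diagram A B) → ∀ {X Y} → X ∈ boxes d → Y ∈ Pa X → Y ∈ A ⊎ Y ∈ boxes d
  parent-label (g ∘ f) i p with ∈-++⁻ (boxes f) i
  ... | inj₁ j = Sum.map₂ ∈-++⁺ˡ (parent-label f j p)
  ... | inj₂ j with parent-label g j p
  ...   | inj₂ k = inj₂ (∈-++⁺ʳ (boxes f) k)
  ...   | inj₁ k = Sum.map₂ ∈-++⁺ˡ (output-label f k)
  parent-label (_⊗_ {A} f g) i p with ∈-++⁻ (boxes f) i
  ... | inj₁ j = Sum.map ∈-++⁺ˡ ∈-++⁺ˡ (parent-label f j p)
  ... | inj₂ j = Sum.map (∈-++⁺ʳ A) (∈-++⁺ʳ (boxes f)) (parent-label g j p)
  parent-label (c X _) (here refl) p = inj₁ p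

  -- Unlike `Path (_∈ bs)`, a flow need not start at a box, so it can also start from an input wire
  -- of the diagram.
  data Flow (bs B : List Vertex) : Vertex → Set where
    done : ∀ {X} → X ∈ B → Flow bs B X
    via  : ∀ {X Y} → X ⟶ Y → Y ∈ bs → Flow bs B Y → Flow bs B X

  Flow-bind : ∀ {bs bs′ X} → (∀ {Y} → Y ∈ bs → Y ∈ bs′) → Flow bs B X →
              (∀ {Y} → Y ∈ B → Flow bs′ C Y) → Flow bs′ C X
  Flow-bind s (done i)    k = k i
  Flow-bind s (via e i f) k = via e (s i) (Flow-bind s f k)

  Flow⇒Path : ∀ {bs X} → X ∈ bs → Flow bs B X → ∃[ Y ] (Y ∈ B × Path (_∈ bs) X Y)
  Flow⇒Path i (done j)    = _ , j , stop i
  Flow⇒Path i (via e j f) with Y , k , p ← Flow⇒Path j f = Y , k , step i e p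

  -- Diagrams in which every wire and every box has a path to an output.
  data Tight : Diagram A B → Set where
    id   : Tight (id {A})
    _∘_  : {g : Diagram B C} {f : Diagram A B} → Tight g → Tight f → Tight (g ∘ f)
    _⊗_  : {f : Diagram A B} {g : Diagram C E} → Tight f → Tight g → Tight (f ⊗ g)
    σ    : ∀ A B → Tight (σ A B)
    copy : ∀ X → Tight (copy [ X ])
    c    : ∀ X X∉in → Tight (c X X∉in)

  -- In a composite, a flow through the first factor ends at an input wire of the second and is
  -- continued there.
  tight-flow : {d : Diagram A B} → Tight d → ∀ {X} → X ∈ A ⊎ X ∈ boxes d → Flow (boxes d) B X
  tight-flow id (inj₁ i) = done i
  tight-flow {d = g ∘ f} (s ∘ t) {X} i = go (Sum.map₂ (∈-++⁻ (boxes f)) i)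
    where
    after : ∀ {Y} → Y ∈ _ ⊎ Y ∈ boxes g → Flow (boxes f ++ boxes g) _ Y
    after j = Flow-bind (∈-++⁺ʳ (boxes f)) (tight-flow s j) done
    go : X ∈ _ ⊎ X ∈ boxes f ⊎ X ∈ boxes g → Flow (boxes f ++ boxes g) _ X
    go (inj₁ j)        = Flow-bind ∈-++⁺ˡ (tight-flow t (inj₁ j)) (after ∘′ inj₁)
    go (inj₂ (inj₁ j)) = Flow-bind ∈-++⁺ˡ (tight-flow t (inj₂ j)) (after ∘′ inj₁)
    go (inj₂ (inj₂ j)) = after (inj₂ j)
  tight-flow {d = _⊗_ {A} {B} f g} (s ⊗ t) {X} i = go (Sum.map (∈-++⁻ A) (∈-++⁻ (boxes f)) i)
    where
    left : X ∈ _ ⊎ X ∈ boxes f → Flow (boxes f ++ boxes g) _ X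
    left j = Flow-bind ∈-++⁺ˡ (tight-flow s j) (done ∘′ ∈-++⁺ˡ)
    right : X ∈ _ ⊎ X ∈ boxes g → Flow (boxes f ++ boxes g) _ X
    right j = Flow-bind (∈-++⁺ʳ (boxes f)) (tight-flow t j) (done ∘′ ∈-++⁺ʳ B)
    go : (X ∈ _ ⊎ X ∈ _) ⊎ (X ∈ boxes f ⊎ X ∈ boxes g) → Flow (boxes f ++ boxes g) _ X
    go (inj₁ (inj₁ j)) = left (inj₁ j)
    go (inj₁ (inj₂ j)) = right (inj₁ j)
    go (inj₂ (inj₁ j)) = left (inj₂ j)
    go (inj₂ (inj₂ j)) = right (inj₂ j)
  tight-flow (σ A B) (inj₁ i) = done ([ ∈-++⁺ʳ B , ∈-++⁺ˡ ]′ (∈-++⁻ A i))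
  tight-flow (copy X) (inj₁ i) = done (∈-++⁺ˡ i)
  tight-flow (c X _) (inj₁ i) = via (∈-Pa⁻ i) (here refl) (done (here refl))
  tight-flow (c X _) (inj₂ i) = done i

module Tightening (G : OpenDAG) where
  open OpenDAG G
  open Free G
  open Network G
  open Labels G using (Tight; id; _∘_; _⊗_; σ; copy; c)
  open Wirings G using (Wiring; id; _⊗_; discard; boxes-wiring)

  private
    variable
      A B C E A′ B′ C′ : List Vertex

  ≈-setoid : List Vertex → List Vertex → Setoid 0ℓ 0ℓ
  ≈-setoid A B = record
    { Carrier = Diagram A B ; _≈_ = _≈_
    ; isEquivalence = record { refl = ≈-refl ; sym = ≈-sym ; trans = ≈-trans } }

  module ≈-Reasoning {A B} = SetoidReasoning (≈-setoid A B)

  del : A′ ⊑ A → Diagram A A′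
  del []                 = id
  del (X ∷ʳ θ)           = discard [ X ] ⊗ del θ
  del (_∷_ {X} refl θ)   = id {[ X ]} ⊗ del θ

  del-wiring : (θ : A′ ⊑ A) → Wiring (del θ)
  del-wiring []         = id
  del-wiring (X ∷ʳ θ)   = discard [ X ] ⊗ del-wiring θ
  del-wiring (refl ∷ θ) = id ⊗ del-wiring θ

  all : (A : List Vertex) → A ⊑ A
  all []      = []
  all (X ∷ A) = refl ∷ all A

  none : (A : List Vertex) → [] ⊑ A
  none []      = []
  none (X ∷ A) = X ∷ʳ none A

  del-all : ∀ A → del (all A) ≈ id
  del-all []      = ≈-refl
  del-all (X ∷ A) = ≈-trans (⊗-resp-≈ ≈-refl (del-all A)) ⊗-identity

  infixr 5 _⊕_
  _⊕_ : A′ ⊑ A → B′ ⊑ B → A′ ++ B′ ⊑ A ++ B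
  []       ⊕ φ = φ
  (X ∷ʳ θ) ⊕ φ = X ∷ʳ (θ ⊕ φ)
  (p ∷ θ)  ⊕ φ = p ∷ (θ ⊕ φ)

  data Split (A B : List Vertex) : ∀ {C} → C ⊑ A ++ B → Set where
    split : (θ : A′ ⊑ A) (φ : B′ ⊑ B) → Split A B (θ ⊕ φ)

  split? : ∀ A B (θ : C ⊑ A ++ B) → Split A B θ
  split? []      B θ = split [] θ
  split? (X ∷ A) B (.X ∷ʳ θ) with split θ φ ← split? A B θ = split (X ∷ʳ θ) φ
  split? (X ∷ A) B (p ∷ θ)   with split θ φ ← split? A B θ = split (p ∷ θ) φ

  del-⊕ : (θ : A′ ⊑ A) (φ : B′ ⊑ B) → del (θ ⊕ φ) ≈ del θ ⊗ del φ
  del-⊕ []         φ = ≈-sym ⊗-unitˡ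
  del-⊕ (X ∷ʳ θ)   φ = begin
    discard [ X ] ⊗ del (θ ⊕ φ)                ≈⟨ ⊗-resp-≈ ≈-refl (del-⊕ θ φ) ⟩
    -- The two `id` introduced here are associators, which reduce to `id` when their first list is
    -- empty or a singleton.
    discard [ X ] ⊗ (del θ ⊗ del φ)            ≈⟨ identityʳ ⟨
    (discard [ X ] ⊗ (del θ ⊗ del φ)) ∘ id     ≈⟨ ⊗-assoc ⟨
    id ∘ ((discard [ X ] ⊗ del θ) ⊗ del φ)     ≈⟨ identityˡ ⟩
    (discard [ X ] ⊗ del θ) ⊗ del φ            ∎
    where open ≈-Reasoning
  del-⊕ (_∷_ {X} refl θ) φ = begin
    id {[ X ]} ⊗ del (θ ⊕ φ)                ≈⟨ ⊗-resp-≈ ≈-refl (del-⊕ θ φ) ⟩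
    id {[ X ]} ⊗ (del θ ⊗ del φ)            ≈⟨ identityʳ ⟨
    (id {[ X ]} ⊗ (del θ ⊗ del φ)) ∘ id     ≈⟨ ⊗-assoc ⟨
    id ∘ ((id {[ X ]} ⊗ del θ) ⊗ del φ)     ≈⟨ identityˡ ⟩
    (id {[ X ]} ⊗ del θ) ⊗ del φ            ∎
    where open ≈-Reasoning

  -- Quantifying over all deletions `θ` of outputs makes the property inductive: in a composite, the
  -- deletion that emerges from the second factor is then pushed through the first.
  Tightenable : Diagram A B → Set
  Tightenable {A} {B} d = ∀ {B′} (θ : B′ ⊑ B) →
    ∃[ A′ ] Σ[ φ ∈ A′ ⊑ A ] Σ[ d′ ∈ Diagram A′ B′ ] (Tight d′ × del θ ∘ d ≈ d′ ∘ del φ)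

  tightenable-≈ : {d e : Diagram A B} → d ≈ e → Tightenable d → Tightenable e
  tightenable-≈ eq t θ with _ , φ , d′ , tight , p ← t θ =
    _ , φ , d′ , tight , ≈-trans (∘-resp-≈ ≈-refl (≈-sym eq)) p

  tightenable-id : Tightenable (id {A})
  tightenable-id θ = _ , θ , id , id , ≈-trans identityʳ (≈-sym identityˡ)

  tightenable-coe : (p : A ≡ B) → Tightenable (coe p)
  tightenable-coe refl = tightenable-id

  tightenable-∘ : {g : Diagram B C} {f : Diagram A B} → Tightenable g → Tightenable f → Tightenable (g ∘ f)
  tightenable-∘ {g = g} {f} t u θ
    with _ , φ , g′ , t′ , p ← t θ
    with _ , ψ , f′ , u′ , q ← u φ = _ , ψ , g′ ∘ f′ , t′ ∘ u′ , (begin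
      del θ ∘ (g ∘ f)    ≈⟨ assoc ⟨
      (del θ ∘ g) ∘ f    ≈⟨ ∘-resp-≈ p ≈-refl ⟩
      (g′ ∘ del φ) ∘ f   ≈⟨ assoc ⟩
      g′ ∘ (del φ ∘ f)   ≈⟨ ∘-resp-≈ ≈-refl q ⟩
      g′ ∘ (f′ ∘ del ψ)  ≈⟨ assoc ⟨
      (g′ ∘ f′) ∘ del ψ  ∎)
    where open ≈-Reasoning

  tightenable-⊗ : {f : Diagram A B} {g : Diagram C E} → Tightenable f → Tightenable g → Tightenable (f ⊗ g)
  tightenable-⊗ {B = B} {E = E} {f} {g} t u θ with split θ₁ θ₂ ← split? B E θ
    with _ , φ , f′ , t′ , p ← t θ₁
    with _ , ψ , g′ , u′ , q ← u θ₂ = _ , φ ⊕ ψ , f′ ⊗ g′ , t′ ⊗ u′ , (begin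
      del (θ₁ ⊕ θ₂) ∘ (f ⊗ g)        ≈⟨ ∘-resp-≈ (del-⊕ θ₁ θ₂) ≈-refl ⟩
      (del θ₁ ⊗ del θ₂) ∘ (f ⊗ g)    ≈⟨ ⊗-homomorphism ⟨
      (del θ₁ ∘ f) ⊗ (del θ₂ ∘ g)    ≈⟨ ⊗-resp-≈ p q ⟩
      (f′ ∘ del φ) ⊗ (g′ ∘ del ψ)    ≈⟨ ⊗-homomorphism ⟩
      (f′ ⊗ g′) ∘ (del φ ⊗ del ψ)    ≈⟨ ∘-resp-≈ ≈-refl (del-⊕ φ ψ) ⟨
      (f′ ⊗ g′) ∘ del (φ ⊕ ψ)        ∎)
    where open ≈-Reasoning

  tightenable-σ : ∀ A B → Tightenable (σ A B)
  tightenable-σ A B θ with split {B′} {A′} θ₁ θ₂ ← split? B A θ = _ , θ₂ ⊕ θ₁ , σ A′ B′ , σ A′ B′ , (begin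
    del (θ₁ ⊕ θ₂) ∘ σ A B        ≈⟨ ∘-resp-≈ (del-⊕ θ₁ θ₂) ≈-refl ⟩
    (del θ₁ ⊗ del θ₂) ∘ σ A B    ≈⟨ σ-natural ⟨
    σ A′ B′ ∘ (del θ₂ ⊗ del θ₁)    ≈⟨ ∘-resp-≈ ≈-refl (del-⊕ θ₂ θ₁) ⟨
    σ A′ B′ ∘ del (θ₂ ⊕ θ₁)        ∎)
    where open ≈-Reasoning

  into-unit : (f g : Diagram A []) → f ≈ g
  into-unit f g = ≈-trans (discard-unique f) (≈-sym (discard-unique g))

  -- Since the unit is terminal, all of `d` collapses to a discard of its inputs, boxes included.
  tightenable-discard : (d : Diagram A []) → Tightenable d
  tightenable-discard {A} d [] = _ , none A , id , id , into-unit _ _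

  tightenable-c : ∀ X X∉in → Tightenable (c X X∉in)
  tightenable-c X X∉in (.X ∷ʳ []) = _ , none (Pa X) , id , id , into-unit _ _
  tightenable-c X X∉in (refl ∷ []) = _ , all (Pa X) , c X X∉in , c X X∉in ,
    ≈-trans (≈-trans (∘-resp-≈ ⊗-identity ≈-refl) identityˡ)
            (≈-sym (≈-trans (∘-resp-≈ ≈-refl (del-all (Pa X))) identityʳ))

  -- If one copy is deleted, a counit law turns `copy` into a plain wire; if both are, the wire
  -- itself is deleted.
  tightenable-copy₁ : ∀ X → Tightenable (copy [ X ])
  tightenable-copy₁ X (.X ∷ʳ .X ∷ʳ []) = _ , X ∷ʳ [] , id , id , into-unit _ _
  tightenable-copy₁ X (.X ∷ʳ refl ∷ []) = _ , refl ∷ [] , id , id , (begin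
    (discard [ X ] ⊗ (id ⊗ id)) ∘ copy [ X ]   ≈⟨ ∘-resp-≈ (⊗-resp-≈ ≈-refl ⊗-identity) ≈-refl ⟩
    (discard [ X ] ⊗ id) ∘ copy [ X ]          ≈⟨ copy-counitˡ ⟩
    id                                         ≈⟨ ⊗-identity ⟨
    id ⊗ id                                    ≈⟨ identityˡ ⟨
    id ∘ (id ⊗ id)                             ∎)
    where open ≈-Reasoning
  tightenable-copy₁ X (refl ∷ .X ∷ʳ []) = _ , refl ∷ [] , id , id , (begin
    (id ⊗ (discard [ X ] ⊗ id)) ∘ copy [ X ]   ≈⟨ ∘-resp-≈ (⊗-resp-≈ ≈-refl (into-unit _ _)) ≈-refl ⟩
    (id ⊗ discard [ X ]) ∘ copy [ X ]          ≈⟨ identityˡ ⟨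
    id ∘ ((id ⊗ discard [ X ]) ∘ copy [ X ])   ≈⟨ copy-counitʳ ⟩
    id                                         ≈⟨ ⊗-identity ⟨
    id ⊗ id                                    ≈⟨ identityˡ ⟨
    id ∘ (id ⊗ id)                             ∎)
    where open ≈-Reasoning
  tightenable-copy₁ X (refl ∷ refl ∷ []) = _ , refl ∷ [] , copy [ X ] , copy X , (begin
    (id {[ X ]} ⊗ (id {[ X ]} ⊗ id {[]})) ∘ copy [ X ]              ≈⟨ ∘-resp-≈ (≈-trans (⊗-resp-≈ ≈-refl ⊗-identity) ⊗-identity) ≈-refl ⟩
    id ∘ copy [ X ]                            ≈⟨ identityˡ ⟩
    copy [ X ]                                 ≈⟨ identityʳ ⟨
    copy [ X ] ∘ id                            ≈⟨ ∘-resp-≈ ≈-refl ⊗-identity ⟨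
    copy [ X ] ∘ (id {[ X ]} ⊗ id {[]})                     ∎)
    where open ≈-Reasoning

  -- A deletion may keep different wires in the two copies of `A`, so `copy-⊗` is used to copy the
  -- wires one at a time.
  tightenable-copy : ∀ A → Tightenable (copy A)
  tightenable-copy []      = tightenable-discard (copy [])
  tightenable-copy (X ∷ A) = tightenable-≈ (≈-sym (copy-⊗ {[ X ]} {A}))
    (tightenable-∘ (tightenable-coe (sym (++-assoc [ X ] A (X ∷ A))))
      (tightenable-∘
        (tightenable-⊗ tightenable-id
          (tightenable-∘ (tightenable-coe (++-assoc A [ X ] A))
            (tightenable-∘ (tightenable-⊗ (tightenable-σ [ X ] A) tightenable-id)
              (tightenable-coe (sym (++-assoc [ X ] A A))))))
        (tightenable-∘ (tightenable-coe (++-assoc [ X ] [ X ] (A ++ A)))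
          (tightenable-⊗ (tightenable-copy₁ X) (tightenable-copy A)))))

  tightenable : (d : Diagram A B) → Tightenable d
  tightenable id          = tightenable-id
  tightenable (g ∘ f)     = tightenable-∘ (tightenable g) (tightenable f)
  tightenable (f ⊗ g)     = tightenable-⊗ (tightenable f) (tightenable g)
  tightenable (σ A B)     = tightenable-σ A B
  tightenable (copy A)    = tightenable-copy A
  tightenable (discard A) = tightenable-discard (discard A)
  tightenable (c X X∉in)  = tightenable-c X X∉in

  data Normal : Diagram A B → Set where
    _∘del_ : {d : Diagram A′ B} → Tight d → (φ : A′ ⊑ A) → Normal (d ∘ del φ)

  -- The normal form arises by pushing back the deletion that keeps all outputs.
  normalise : (d : Diagram A B) → ∃[ d′ ] (d′ ≈ d × Normal d′)
  normalise {B = B} d with _ , φ , d′ , t , p ← tightenable d (all B) =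
    d′ ∘ del φ , ≈-trans (≈-sym p) (≈-trans (∘-resp-≈ (del-all B) ≈-refl) identityˡ) , t ∘del φ

  normal⇒normalised : {d : Diagram A B} → Normal d → IsNormalised d
  normal⇒normalised (_∘del_ {d = d} t φ) i rewrite boxes-wiring (del-wiring φ) =
    Labels.Flow⇒Path G i (Labels.tight-flow G t (inj₂ i))

-- Names contributed by the boxes of a diagram

map-split : ∀ {a b} {A : Set a} {B : Set b} (f : A → B) xs ys {zs} → map f xs ≡ ys ++ zs →
            ∃[ us ] ∃[ vs ] (xs ≡ us ++ vs × map f us ≡ ys × map f vs ≡ zs)
map-split f xs       []       eq = [] , xs , refl , refl , eq
map-split f (x ∷ xs) (y ∷ ys) eq with refl , eq′ ← ∷-injective eq
  with us , vs , refl , refl , refl ← map-split f xs ys eq′ = x ∷ us , vs , refl , refl , refl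

module Names (G : OpenDAG) {N : Set} (n₀ : N) where
  open OpenDAG G
  open Free G
  open Network G
  open Labels G using (Tight; id; _∘_; _⊗_; σ; copy; c)
  open Tightening G using (Normal; _∘del_; del; del-wiring)
  open Wirings G using (boxes-wiring)

  Value : Set
  Value = List (Vertex × N)

  Named : Vertex → List Value → Value → Set
  Named X x v = ∃[ n ] (v ≡ (X , n) ∷ concat x)

  -- The name `n₀` guarantees that every box has an output.
  open Semantics G Named (λ X x → _ , n₀ , refl) public

  private
    variable
      A B : List Vertex
      x y : List Value

  infix 4 _∈ᵛ_
  _∈ᵛ_ : Vertex × N → List Value → Set
  p ∈ᵛ x = Any (p ∈_) x

  empty-nameless : ∀ (A : List Vertex) {p} → ¬ (p ∈ᵛ map (λ _ → []) A)
  empty-nameless (_ ∷ A) (there i) = empty-nameless A i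

  -- An upper bound on the new names: `T` is read off from the derivation and has one entry for each
  -- occurrence of a box, carrying its label.
  names-from-boxes : (d : Diagram A B) → ⟦ d ⟧ x y →
                     ∃[ T ] (map proj₁ T ≡ boxes d × (∀ {p} → p ∈ᵛ y → p ∈ᵛ x ⊎ p ∈ T))
  names-from-boxes id (_ , refl) = [] , refl , inj₁
  names-from-boxes (g ∘ f) (_ , p , q)
    with S , S-labels , s ← names-from-boxes f p
    with T , T-labels , t ← names-from-boxes g q =
    S ++ T , trans (map-++ proj₁ S T) (cong₂ _++_ S-labels T-labels) ,
    λ i → [ (λ j → Sum.map₂ ∈-++⁺ˡ (s j)) , (λ j → inj₂ (∈-++⁺ʳ S j)) ]′ (t i)
  names-from-boxes (f ⊗ g) (x₁ , _ , y₁ , _ , refl , refl , p , q)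
    with S , S-labels , s ← names-from-boxes f p
    with T , T-labels , t ← names-from-boxes g q =
    S ++ T , trans (map-++ proj₁ S T) (cong₂ _++_ S-labels T-labels) ,
    λ i → [ (λ j → Sum.map Any-++⁺ˡ ∈-++⁺ˡ (s j)) ,
            (λ j → Sum.map (Any-++⁺ʳ x₁) (∈-++⁺ʳ S) (t j)) ]′ (Any-++⁻ y₁ i)
  names-from-boxes (σ A B) (x₁ , x₂ , refl , refl , _) =
    [] , refl , λ i → inj₁ ([ Any-++⁺ʳ x₁ , Any-++⁺ˡ ]′ (Any-++⁻ x₂ i))
  names-from-boxes (copy A) (_ , refl) =
    [] , refl , λ i → inj₁ ([ (λ j → j) , (λ j → j) ]′ (Any-++⁻ _ i))
  names-from-boxes (discard A) (_ , refl) = [] , refl , λ ()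
  names-from-boxes {x = x} (c X _) (_ , _ , refl , n , refl) = [ X , n ] , refl ,
    λ { (here (here eq)) → inj₂ (here eq) ; (here (there i)) → inj₁ (concat⁻ x i) }

  -- A lower bound: the boxes are made to choose the prescribed names `S`, and as a tight diagram
  -- contains no discards, nothing on its wires is lost.
  tight-names : {d : Diagram A B} → Tight d → x ≍ A → ∀ S → map proj₁ S ≡ boxes d →
                ∃[ y ] (⟦ d ⟧ x y × (∀ {p} → p ∈ᵛ x ⊎ p ∈ S → p ∈ᵛ y))
  tight-names id l [] refl = _ , (l , refl) , [ (λ i → i) , (λ ()) ]′
  tight-names {d = g ∘ f} (s ∘ t) l S eq
    with S₁ , S₂ , refl , eq₁ , eq₂ ← map-split proj₁ S (boxes f) eq
    with y , p , k ← tight-names t l S₁ eq₁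
    with z , q , k′ ← tight-names s (cod f p) S₂ eq₂ = z , (y , p , q) ,
    λ i → k′ ([ (λ j → inj₁ (k (inj₁ j))) , (λ j → Sum.map₁ (λ m → k (inj₂ m)) (∈-++⁻ S₁ j)) ]′ i)
  tight-names {d = _⊗_ {A} {C = C} f g} (s ⊗ t) l S eq
    with x₁ , x₂ , refl , l₁ , l₂ ← ≍-split A C l
    with S₁ , S₂ , refl , eq₁ , eq₂ ← map-split proj₁ S (boxes f) eq
    with y₁ , p , k ← tight-names s l₁ S₁ eq₁
    with y₂ , q , k′ ← tight-names t l₂ S₂ eq₂ = y₁ ++ y₂ , _⊠_ {f = f} {g = g} p q , names
    where
    names : ∀ {p} → p ∈ᵛ x₁ ++ x₂ ⊎ p ∈ S₁ ++ S₂ → p ∈ᵛ y₁ ++ y₂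
    names i with Sum.map (Any-++⁻ x₁) (∈-++⁻ S₁) i
    ... | inj₁ (inj₁ j) = Any-++⁺ˡ (k (inj₁ j))
    ... | inj₁ (inj₂ j) = Any-++⁺ʳ y₁ (k′ (inj₁ j))
    ... | inj₂ (inj₁ j) = Any-++⁺ˡ (k (inj₂ j))
    ... | inj₂ (inj₂ j) = Any-++⁺ʳ y₁ (k′ (inj₂ j))
  tight-names (σ A B) l [] refl with x₁ , x₂ , refl , l₁ , l₂ ← ≍-split A B l =
    _ , (x₁ , x₂ , refl , refl , l₁ , l₂) ,
    [ (λ i → [ Any-++⁺ʳ x₂ , Any-++⁺ˡ ]′ (Any-++⁻ x₁ i)) , (λ ()) ]′
  tight-names (copy X) l [] refl = _ , (l , refl) , [ Any-++⁺ˡ , (λ ()) ]′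
  tight-names {x = x} (c X _) l ((.X , n) ∷ []) refl = _ , (l , _ , refl , n , refl) ,
    λ { (inj₁ i) → here (there (concat⁺ i)) ; (inj₂ (here eq)) → here (here eq) }

  -- The deletion `del φ` precedes all boxes: it may lose names of the inputs, but none of those in
  -- `S`.
  normal-names : {d : Diagram A B} → Normal d → x ≍ A → ∀ S → map proj₁ S ≡ boxes d →
                 ∃[ y ] (⟦ d ⟧ x y × (∀ {p} → p ∈ S → p ∈ᵛ y))
  normal-names (_∘del_ {d = d} t φ) l S eq rewrite boxes-wiring (del-wiring φ)
    with x′ , p ← total (del φ) l
    with y , q , k ← tight-names t (cod (del φ) p) S eq = y , (x′ , p , q) , λ i → k (inj₂ i)

-- Isomorphisms of the free category

module Isomorphisms (G : OpenDAG) where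
  open OpenDAG G
  open Free G
  open Network G
  open Wirings G using (Wiring; id; _∘_; _⊗_; σ; copy; discard; boxless⇒wiring)
  open Labels G using (output-label)
  open Tightening G using (Normal; normalise; module ≈-Reasoning)
  open SymmetricMonoidalCategory symmetricMonoidal using (IsIso)

  private
    module Sem = Semantics G (λ _ _ (_ : ℕ) → ⊤) (λ _ _ → 0 , tt)

    variable
      A B : List Vertex

  -- Let `g` and then `f` act on nameless values. As `f ∘ g ≈ id`, nameless values come back,
  -- whereas a box of the normal diagram `f` would have left its name.
  normal-retraction-boxless : (f : Diagram A B) (g : Diagram B A) → f ∘ g ≈ id → Normal f → boxes f ≡ []
  normal-retraction-boxless {B = B} f g fg≈id nf = no-boxes (boxes f) refl
    where
    -- A single name suffices, since only the presence of a name matters.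
    open Names G tt
    no-boxes : ∀ bs → boxes f ≡ bs → bs ≡ []
    no-boxes []       _  = refl
    no-boxes (X ∷ bs) eq
      with x , p ← total g (≍-map (λ _ → []) B)
      with S , S-labels , _ ← ≍-zip (≍-map (λ _ → tt) (boxes f))
      with y , q , k ← normal-names nf (cod g p) S S-labels
      with _ , refl ← proj₁ (sound fg≈id) (x , p , q)
      with _ , i , _ ← ∈-map⁻ proj₁ (subst (X ∈_) (trans (sym eq) (sym S-labels)) (here refl))
      = contradiction (k i) (empty-nameless B)

  boxless-iso : {f : Diagram A B} → IsIso f → ∃[ f′ ] (f′ ≈ f × boxes f′ ≡ [])
  boxless-iso {f = f} (g , _ , fg≈id) with f′ , f′≈f , nf ← normalise f =
    f′ , f′≈f , normal-retraction-boxless f′ g (≈-trans (∘-resp-≈ f′≈f ≈-refl) fg≈id) nf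

  boxless-label : (f : Diagram A B) → boxes f ≡ [] → ∀ {X} → X ∈ B → X ∈ A
  boxless-label f eq i with output-label f i
  ... | inj₁ j = j
  ... | inj₂ j with () ← subst (_ ∈_) eq j

  -- Distinct labels allow a list of values to be written as a function of the label; `v₀` is the
  -- starting value, kept at the labels outside `A`.
  valuation-of : ∀ {V : Set} → V → Unique A → (x : List V) → x ≍ A → ∃[ v ] x ≡ map v A
  valuation-of v₀ [] [] [] = (λ _ → v₀) , refl
  valuation-of {X ∷ A} v₀ (X∉A ∷ A-unique) (n ∷ x) ((_ ∷ _) l) with v , refl ← valuation-of v₀ A-unique x l =
    v′ , cong₂ _∷_ (sym (cong (if_then n else v X) (dec-true (X ≟ X) refl)))
                   (map-cong-local (All.map (λ {Z} X≢Z → sym (cong (if_then n else v Z) (dec-false (X ≟ Z) X≢Z))) X∉A))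
    where
    v′ : Vertex → _
    v′ Z = if does (X ≟ Z) then n else v Z

  -- Put distinct numbers on the wires `B` and carry them to `A` by `g`. There they are a function
  -- `v` of the label, and the boxless representative of `f` preserves this form, so the numbers at
  -- the start were `map v B`.
  iso-unique : {f : Diagram A B} → IsIso f → Unique A → Unique B
  iso-unique {A} {B} {f} iso@(g , _ , fg≈id) A-unique
    with f′ , f′≈f , eq ← boxless-iso iso
    with x , p ← Sem.total g (≍-length (upTo (length B)) B (length-upTo _))
    with v , refl ← valuation-of 0 A-unique x (Sem.cod g p)
    with _ , upTo≡map ← proj₁ (Sem.sound fg≈id) (_ , p , proj₁ (Sem.sound f′≈f) (Sem.wiring-map (boxless⇒wiring f′ eq) v))
    = map⁻ (subst Unique upTo≡map (upTo⁺ (length B)))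

-- Images of diagrams under a cd-functor

module Image (GL GH : OpenDAG) (F : CDFunctor (Free.category GH) (Free.category GL)) where
  private
    module L where
      open OpenDAG GL public
      open Free GL public
      open Network GL public
    module H where
      open OpenDAG GH public
      open Free GH public
      open Network GH public

  open CDFunctor F
  open Isomorphisms GL
  open Tightening GL using (module ≈-Reasoning)
  open SymmetricMonoidalCategory L.symmetricMonoidal using (IsIso)

  private
    variable
      A B C E : List H.Vertex

  π : H.Vertex → List L.Vertex
  π X = F₀ [ X ]

  πs : List H.Vertex → List L.Vertex
  πs = concatMap π

  module _ (r : ∀ X → X ∉ˢ H.inputs → L.Diagram (F₀ (H.Pa X)) (π X))
           (r-represents : ∀ X X∉in → r X X∉in L.≈ F₁ (H.c X X∉in)) where

    -- An input has no mechanism; the value `[]` makes this a function on all variables, which can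
    -- be mapped over the boxes of a diagram.
    mechanismBoxes : H.Vertex → List L.Vertex
    mechanismBoxes X with X ∈ˢ? H.inputs
    ... | yes _    = []
    ... | no  X∉in = L.boxes (r X X∉in)

    mechanismBoxes-nonInput : ∀ X X∉in → mechanismBoxes X ≡ L.boxes (r X X∉in)
    mechanismBoxes-nonInput X X∉in with X ∈ˢ? H.inputs
    ... | yes X∈in = contradiction X∈in X∉in
    ... | no  _    = refl

    μ⁻ : ∀ A B → L.Diagram (F₀ (A ++ B)) (F₀ A ++ F₀ B)
    μ⁻ A B = proj₁ (μ-iso A B)

    -- The laws `μ-natural` and `μ-sym` have the shape of the hypothesis; this turns them into
    -- formulas for the images of `⊗` and `σ`.
    conjugate : (f : H.Diagram (A ++ B) (C ++ E)) {g : L.Diagram (F₀ A ++ F₀ B) (F₀ C ++ F₀ E)} →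
                F₁ f L.∘ μ A B L.≈ μ C E L.∘ g → (μ C E L.∘ g) L.∘ μ⁻ A B L.≈ F₁ f
    conjugate {A} {B} {C} {E} f {g} eq = begin
      (μ C E L.∘ g) L.∘ μ⁻ A B      ≈⟨ L.∘-resp-≈ eq L.≈-refl ⟨
      (F₁ f L.∘ μ A B) L.∘ μ⁻ A B   ≈⟨ L.assoc ⟩
      F₁ f L.∘ (μ A B L.∘ μ⁻ A B)   ≈⟨ L.∘-resp-≈ L.≈-refl (proj₂ (proj₂ (μ-iso A B))) ⟩
      F₁ f L.∘ L.id                 ≈⟨ L.identityʳ ⟩
      F₁ f                          ∎
      where open ≈-Reasoning

    boxless-μ : ∀ A B → ∃[ m ] (m L.≈ μ A B × L.boxes m ≡ [])
    boxless-μ A B = boxless-iso (μ-iso A B)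

    boxless-μ⁻ : ∀ A B → ∃[ m ] (m L.≈ μ⁻ A B × L.boxes m ≡ [])
    boxless-μ⁻ A B = boxless-iso (μ A B , proj₂ (proj₂ (μ-iso A B)) , proj₁ (proj₂ (μ-iso A B)))

    -- Replace every box of `h` by the chosen representative of its image. The structure maps
    -- inserted in between are isomorphisms, hence have representatives without boxes.
    image-boxes : (h : H.Diagram A B) →
                  ∃[ d ] (d L.≈ F₁ h × L.boxes d ≡ concatMap mechanismBoxes (H.boxes h))
    image-boxes H.id = L.id , L.≈-sym identity , refl
    image-boxes (h H.∘ k)
      with d , d≈ , p ← image-boxes h
      with e , e≈ , q ← image-boxes k =
      d L.∘ e , L.≈-trans (L.∘-resp-≈ d≈ e≈) (L.≈-sym homomorphism) ,
      trans (cong₂ _++_ q p) (sym (concatMap-++ mechanismBoxes (H.boxes k) (H.boxes h)))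
    image-boxes (H._⊗_ {A} {B} {C} {E} h k)
      with d , d≈ , p ← image-boxes h
      with e , e≈ , q ← image-boxes k
      with m , m≈ , m-boxless ← boxless-μ B E
      with w , w≈ , w-boxless ← boxless-μ⁻ A C =
      (m L.∘ (d L.⊗ e)) L.∘ w ,
      L.≈-trans (L.∘-resp-≈ (L.∘-resp-≈ m≈ (L.⊗-resp-≈ d≈ e≈)) w≈) (conjugate (h H.⊗ k) (L.≈-sym μ-natural)) ,
      boxes≡
      where
      boxes≡ : L.boxes w ++ (L.boxes d ++ L.boxes e) ++ L.boxes m ≡
               concatMap mechanismBoxes (H.boxes h ++ H.boxes k)
      boxes≡ rewrite m-boxless | w-boxless | p | q | concatMap-++ mechanismBoxes (H.boxes h) (H.boxes k) = ++-identityʳ _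
    image-boxes (H.σ A B)
      with m , m≈ , m-boxless ← boxless-μ B A
      with w , w≈ , w-boxless ← boxless-μ⁻ A B =
      (m L.∘ L.σ (F₀ A) (F₀ B)) L.∘ w ,
      L.≈-trans (L.∘-resp-≈ (L.∘-resp-≈ m≈ L.≈-refl) w≈) (conjugate (H.σ A B) μ-sym) ,
      cong₂ _++_ w-boxless m-boxless
    image-boxes (H.copy A) with m , m≈ , m-boxless ← boxless-μ A A =
      m L.∘ L.copy (F₀ A) , L.≈-trans (L.∘-resp-≈ m≈ L.≈-refl) (L.≈-sym F-copy) , m-boxless
    image-boxes (H.discard A) with m , m≈ , m-boxless ← boxless-iso ε-iso =
      m L.∘ L.discard (F₀ A) , L.≈-trans (L.∘-resp-≈ m≈ L.≈-refl) (L.≈-sym F-discard) , m-boxless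
    image-boxes (H.c X X∉in) = r X X∉in , r-represents X X∉in ,
      trans (sym (mechanismBoxes-nonInput X X∉in)) (sym (++-identityʳ _))

  iso-∘ : ∀ {A B C} {f : L.Diagram A B} {g : L.Diagram B C} → IsIso g → IsIso f → IsIso (g L.∘ f)
  iso-∘ {f = f} {g} (g⁻ , g⁻g , gg⁻) (f⁻ , f⁻f , ff⁻) =
    f⁻ L.∘ g⁻ , cancel g⁻g f⁻f , cancel ff⁻ gg⁻
    where
    cancel : ∀ {A B C} {f : L.Diagram A B} {g : L.Diagram B C} {g⁻ : L.Diagram C B} {f⁻ : L.Diagram B A} →
             g⁻ L.∘ g L.≈ L.id → f⁻ L.∘ f L.≈ L.id → (f⁻ L.∘ g⁻) L.∘ (g L.∘ f) L.≈ L.id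
    cancel {f = f} {g} {g⁻} {f⁻} p q = begin
      (f⁻ L.∘ g⁻) L.∘ (g L.∘ f)   ≈⟨ L.assoc ⟩
      f⁻ L.∘ (g⁻ L.∘ (g L.∘ f))   ≈⟨ L.∘-resp-≈ L.≈-refl L.assoc ⟨
      f⁻ L.∘ ((g⁻ L.∘ g) L.∘ f)   ≈⟨ L.∘-resp-≈ L.≈-refl (L.∘-resp-≈ p L.≈-refl) ⟩
      f⁻ L.∘ (L.id L.∘ f)         ≈⟨ L.∘-resp-≈ L.≈-refl L.identityˡ ⟩
      f⁻ L.∘ f                    ≈⟨ q ⟩
      L.id                        ∎
      where open ≈-Reasoning

  id-⊗-iso : ∀ {A B C} {f : L.Diagram A B} → IsIso f → IsIso (L.id {C} L.⊗ f)
  id-⊗-iso (f⁻ , f⁻f , ff⁻) = L.id L.⊗ f⁻ , cancel f⁻f , cancel ff⁻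
    where
    cancel : ∀ {A B C} {f : L.Diagram A B} {g : L.Diagram B A} → g L.∘ f L.≈ L.id →
             (L.id {C} L.⊗ g) L.∘ (L.id L.⊗ f) L.≈ L.id
    cancel p = L.≈-trans (L.≈-sym L.⊗-homomorphism) (L.≈-trans (L.⊗-resp-≈ L.identityˡ p) L.⊗-identity)

  -- The functor is only strong, so `F₀ A` need not be the list `πs A`; iterating `μ` gives the
  -- isomorphism between them.
  κ : ∀ A → L.Diagram (πs A) (F₀ A)
  κ []      = ε
  κ (X ∷ A) = μ [ X ] A L.∘ (L.id L.⊗ κ A)

  κ-iso : ∀ A → IsIso (κ A)
  κ-iso []      = ε-iso
  κ-iso (X ∷ A) = iso-∘ (μ-iso [ X ] A) (id-⊗-iso (κ-iso A))

  κ⁻ : ∀ A → L.Diagram (F₀ A) (πs A)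
  κ⁻ A = proj₁ (κ-iso A)

  κ⁻-iso : ∀ A → IsIso (κ⁻ A)
  κ⁻-iso A = κ A , proj₂ (proj₂ (κ-iso A)) , proj₁ (proj₂ (κ-iso A))

  -- Isomorphisms have boxless representatives, which create no labels. Together with the converse
  -- below, the two lists have the same entries.
  F₀⇒πs : ∀ A {W} → W ∈ F₀ A → W ∈ πs A
  F₀⇒πs A i with m , _ , eq ← boxless-iso (κ-iso A) = boxless-label m eq i

  πs⇒F₀ : ∀ A {W} → W ∈ πs A → W ∈ F₀ A
  πs⇒F₀ A i with m , _ , eq ← boxless-iso (κ⁻-iso A) = boxless-label m eq i

  F₀-unique : ∀ A → Unique (πs A) → Unique (F₀ A)
  F₀-unique A = iso-unique (κ-iso A)

  module Valuations {N : Set} (n₀ : N) where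
    open Names GL n₀

    private
      variable
        x y z a b : List Value

    iso-deterministic : ∀ {A B} {f : L.Diagram A B} → IsIso f → ⟦ f ⟧ x y → ⟦ f ⟧ x z → y ≡ z
    iso-deterministic iso p q with m , m≈ , eq ← boxless-iso iso =
      wiring-deterministic (Wirings.boxless⇒wiring GL m eq) (proj₂ (sound m≈) p) (proj₂ (sound m≈) q)

    iso-names : ∀ {A B} {f : L.Diagram A B} → IsIso f → ⟦ f ⟧ x y → ∀ {p} → p ∈ᵛ y → p ∈ᵛ x
    iso-names iso p i with m , m≈ , eq ← boxless-iso iso
      with names-from-boxes m (proj₂ (sound m≈) p)
    ... | T , T-labels , k with k i
    ...   | inj₁ j = j
    ...   | inj₂ j with () ← subst (_ ∈_) (trans T-labels eq) (∈-map⁺ proj₁ j)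

    F-id⁺ : x ≍ F₀ A → ⟦ F₁ (H.id {A}) ⟧ x x
    F-id⁺ l = proj₂ (sound identity) (l , refl)

    -- Coherence of `κ` with concatenation, by induction from the unit and associativity laws of
    -- `μ`. It is stated for values, on which associators act as the identity.
    κ-++⁺ : ∀ A B → ⟦ κ A ⟧ x a → ⟦ κ B ⟧ y b → ⟦ μ A B ⟧ (a ++ b) z → ⟦ κ (A ++ B) ⟧ (x ++ y) z
    κ-++⁺ {y = y} {b} {z} [] B p q m with [] ← dom ε p
      with _ , refl ← proj₁ (sound μ-unitˡ)
        (_ , (_ , _⊠_ {f = ε} {g = L.id} p (cod (κ B) q , refl) , m) , F-id⁺ {A = B} (cod (μ [] B) m)) = q
    κ-++⁺ {y = y} {b} {z} (X ∷ A) B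
      (_ , (x₁ , x₂ , _ , a′ , refl , refl , (l , refl) , p) , m) q m′
      -- The law carries `m` and `m′`, which multiply `X` with `A` first, into `n` and `n′`, which
      -- multiply `A` with `B` first.
      with proj₁ (sound (μ-assoc {[ X ]} {A} {B}))
        (_ , (_ , _⊠_ {f = μ [ X ] A} {g = L.id} m (cod (κ B) q , refl) , m′) , F-id⁺ {A = X ∷ A ++ B} (cod (μ (X ∷ A) B) m′))
    ... | _ , (_ , α , (u₁ , _ , _ , w , eq , refl , (l′ , refl) , n)) , n′
      with refl , refl ← ++-injective l l′ (trans (sym (++-assoc x₁ a′ b)) (trans (coe⁻ (++-assoc (π X) (F₀ A) (F₀ B)) α) eq))
      rewrite ++-assoc x₁ x₂ y
      = _ , (x₁ , x₂ ++ y , x₁ , w , refl , refl , (l , refl) , κ-++⁺ A B p q n) , n′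

    -- By totality `κ A`, `κ B` and `μ A B` have outputs, which `κ-++⁺` combines to an output of
    -- `κ (A ++ B)`; that output is unique.
    κ-++⁻ : ∀ A B → x ≍ πs A → y ≍ πs B → ⟦ κ (A ++ B) ⟧ (x ++ y) z →
            ∃[ a ] ∃[ b ] (⟦ κ A ⟧ x a × ⟦ κ B ⟧ y b × ⟦ μ A B ⟧ (a ++ b) z)
    κ-++⁻ A B l l′ r with a , p ← total (κ A) l with b , q ← total (κ B) l′
      with z , m ← total (μ A B) (≍-++ (cod (κ A) p) (cod (κ B) q))
      with refl ← iso-deterministic (κ-iso (A ++ B)) (κ-++⁺ A B p q m) r = a , b , p , q , m

    -- The map `κ [ X ]` ends in a multiplication with the unit, which `μ-unitʳ` shows to act as the
    -- identity on values.
    κ-[X]⁺ : ∀ X → x ≍ π X → ⟦ κ [ X ] ⟧ (x ++ []) x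
    κ-[X]⁺ {x = x} X l with e , p ← total ε [] with y , m ← total (μ [ X ] []) (≍-++ l (cod ε p))
      = _ , x⊗e , subst (⟦ μ [ X ] [] ⟧ (x ++ e)) (trans (sym y≡) (++-identityʳ x)) m
      where
      x⊗e : ⟦ L.id {π X} L.⊗ ε ⟧ (x ++ []) (x ++ e)
      x⊗e = x , [] , x , e , refl , refl , (l , refl) , p
      y≡ : x ++ [] ≡ y
      y≡ = coe⁻ (++-identityʳ (π X)) (proj₁ (sound (μ-unitʳ {[ X ]}))
             (_ , (_ , x⊗e , m) , F-id⁺ {A = [ X ]} (cod (μ [ X ] []) m)))

    -- A choice of values for the variables of H that is compatible with the mechanisms
    -- is carried along by the image of every diagram.
    module _ (v : H.Vertex → List Value) (v-fits : ∀ X → v X ≍ π X)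
             (v-compatible : ∀ X X∉in {a} → ⟦ κ (H.Pa X) ⟧ (concatMap v (H.Pa X)) a → ⟦ F₁ (H.c X X∉in) ⟧ a (v X)) where

      vs : List H.Vertex → List Value
      vs = concatMap v

      vs-fits : ∀ A → vs A ≍ πs A
      vs-fits []      = []
      vs-fits (X ∷ A) = ≍-++ (v-fits X) (vs-fits A)

      private
        merge : ∀ A B → ⟦ κ A ⟧ (vs A) a → ⟦ κ B ⟧ (vs B) b → ⟦ μ A B ⟧ (a ++ b) z → ⟦ κ (A ++ B) ⟧ (vs (A ++ B)) z
        merge A B p q m = subst (λ x → ⟦ κ (A ++ B) ⟧ x _) (sym (concatMap-++ v A B)) (κ-++⁺ A B p q m)

        unmerge : ∀ A B → ⟦ κ (A ++ B) ⟧ (vs (A ++ B)) z →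
                  ∃[ a ] ∃[ b ] (⟦ κ A ⟧ (vs A) a × ⟦ κ B ⟧ (vs B) b × ⟦ μ A B ⟧ (a ++ b) z)
        unmerge A B r = κ-++⁻ A B (vs-fits A) (vs-fits B) (subst (λ x → ⟦ κ (A ++ B) ⟧ x _) (concatMap-++ v A B) r)

      transport-valuation : (h : H.Diagram A B) → ⟦ κ A ⟧ (vs A) a → ∃[ b ] (⟦ κ B ⟧ (vs B) b × ⟦ F₁ h ⟧ a b)
      transport-valuation {A = A} H.id p = _ , p , F-id⁺ {A = A} (cod (κ A) p)
      transport-valuation (h H.∘ k) p
        with b , q , s ← transport-valuation k p
        with d , r , t ← transport-valuation h q = d , r , proj₂ (sound homomorphism) (b , s , t)
      transport-valuation (H._⊗_ {A} {B} {C} {E} h k) p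
        with a , a′ , p₁ , p₂ , m ← unmerge A C p
        with b , q₁ , s ← transport-valuation h p₁
        with b′ , q₂ , t ← transport-valuation k p₂
        with z , n ← total (μ B E) (≍-++ (cod (κ B) q₁) (cod (κ E) q₂))
        -- Naturality yields a result of `F₁ (h ⊗ k)` at some output of `μ A C`, which determinism
        -- identifies with the given value.
        with _ , m′ , u ← proj₁ (sound (μ-natural {f = h} {k})) (_ , _⊠_ {f = F₁ h} {g = F₁ k} s t , n)
        with refl ← iso-deterministic (μ-iso A C) m m′
        = z , merge B E q₁ q₂ n , u
      transport-valuation (H.σ A B) p
        with a , b , p₁ , p₂ , m ← unmerge A B p
        with z , n ← total (μ B A) (≍-++ (cod (κ B) p₂) (cod (κ A) p₁))
        with _ , m′ , u ← proj₂ (sound (μ-sym {A} {B}))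
          (_ , (a , b , refl , refl , cod (κ A) p₁ , cod (κ B) p₂) , n)
        with refl ← iso-deterministic (μ-iso A B) m m′
        = z , merge B A p₂ p₁ n , u
      transport-valuation {a = a} (H.copy A) p
        with z , n ← total (μ A A) (≍-++ (cod (κ A) p) (cod (κ A) p))
        = z , merge A A p p n , proj₂ (sound F-copy) (_ , (cod (κ A) p , refl) , n)
      transport-valuation (H.discard A) p with e , q ← total ε []
        = e , q , proj₂ (sound F-discard) (_ , (cod (κ A) p , refl) , q)
      transport-valuation (H.c X X∉in) p =
        v X , κ-[X]⁺ X (v-fits X) , v-compatible X X∉in p

-- Construction of a compatible valuation by recursion along the graph

⟶⁺-wellFounded : (G : OpenDAG) → WellFounded (TransClosure (OpenDAG._⟶_ G))
⟶⁺-wellFounded G = spo-wellFounded record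
  { isEquivalence = isEquivalence
  ; irrefl        = λ { refl → acyclic }
  ; trans         = _++⁺_
  ; <-resp-≈      = resp₂ (TransClosure _⟶_)
  }
  where open OpenDAG G

module CompatibleValuation (GL GH : OpenDAG) (F : CDFunctor (Free.category GH) (Free.category GL))
                           {N : Set} (n₀ : N) where
  private
    module L where
      open OpenDAG GL public
      open Free GL public
      open Network GL public
    module H where
      open OpenDAG GH public
      open Free GH public
      open Network GH public

  open CDFunctor F
  open Image GL GH F
  open Names GL n₀
  open Valuations n₀
  open Tightening GL using (Normal)

  module _ (e : ∀ X → X ∉ˢ H.inputs → L.Diagram (F₀ (H.Pa X)) (π X))
           (e-represents : ∀ X X∉in → e X X∉in L.≈ F₁ (H.c X X∉in))
           (e-normal : ∀ X X∉in → Normal (e X X∉in))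
           (S : ∀ X → X ∉ˢ H.inputs → Value)
           (S-labels : ∀ X X∉in → map proj₁ (S X X∉in) ≡ L.boxes (e X X∉in)) where

    Fitting : List L.Vertex → Set
    Fitting A = Σ[ x ∈ List Value ] x ≍ A

    private
      -- An input receives nameless values. For any other variable, the normal form of its mechanism
      -- acts on the values of the parents, and its boxes choose the names `S`. The decision is an
      -- argument so that the lemmas can match on it once `u` is unfolded.
      choose : ∀ X → Dec (X ∈ˢ H.inputs) → Fitting (πs (H.Pa X)) → Fitting (π X)
      choose X (yes _)    _ = map (λ _ → []) (π X) , ≍-map (λ _ → []) (π X)
      choose X (no X∉in) (x , l) with a , p ← total (κ (H.Pa X)) l
        with y , q , _ ← normal-names (e-normal X X∉in) (cod (κ (H.Pa X)) p) (S X X∉in) (S-labels X X∉in)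
        = y , cod (e X X∉in) q

      choose-compatible : ∀ X X∈? x {a} X∉in → ⟦ κ (H.Pa X) ⟧ (proj₁ x) a →
                          ⟦ F₁ (H.c X X∉in) ⟧ a (proj₁ (choose X X∈? x))
      choose-compatible X (yes X∈in) _ X∉in _ = contradiction X∈in X∉in
      choose-compatible X (no X∉in) (x , l) _ p with a , p′ ← total (κ (H.Pa X)) l
        with y , q , _ ← normal-names (e-normal X X∉in) (cod (κ (H.Pa X)) p′) (S X X∉in) (S-labels X X∉in)
        with refl ← iso-deterministic (κ-iso (H.Pa X)) p p′
        = proj₁ (sound (e-represents X X∉in)) q

      choose-names : ∀ X X∈? x {p} X∉in → p ∈ S X X∉in → p ∈ᵛ proj₁ (choose X X∈? x)
      choose-names X (yes X∈in) _ X∉in _ = contradiction X∈in X∉in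
      choose-names X (no X∉in) (x , l) _ i with a , p′ ← total (κ (H.Pa X)) l
        with y , q , k ← normal-names (e-normal X X∉in) (cod (κ (H.Pa X)) p′) (S X X∉in) (S-labels X X∉in)
        = k i

      choose-input : ∀ X X∈? x {p} → X ∈ˢ H.inputs → ¬ (p ∈ᵛ proj₁ (choose X X∈? x))
      choose-input X (yes _) _ _ = empty-nameless (π X)
      choose-input X (no X∉in) _ X∈in = contradiction X∈in X∉in

      join : ∀ {A B} → Fitting A → Fitting B → Fitting (A ++ B)
      join (x , l) (y , l′) = x ++ y , ≍-++ l l′

      -- The membership proof handed to `f` supplies the edge that justifies the recursive call in
      -- `extend`.
      gather : ∀ A → (∀ {X} → X ∈ A → Fitting (π X)) → Fitting (πs A)
      gather []      f = [] , []
      gather (X ∷ A) f = join (f (here refl)) (gather A (f ∘′ there))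

      gather-cong : ∀ A {f g : ∀ {X} → X ∈ A → Fitting (π X)} →
                    (∀ {X} (i : X ∈ A) → f i ≡ g i) → gather A f ≡ gather A g
      gather-cong []      eq = refl
      gather-cong (X ∷ A) eq = cong₂ join (eq (here refl)) (gather-cong A (λ i → eq (there i)))

      extend : ∀ X → (∀ {Y} → TransClosure H._⟶_ Y X → Fitting (π Y)) → Fitting (π X)
      extend X v = choose X (X ∈ˢ? H.inputs) (gather (H.Pa X) (λ i → v [ Labels.∈-Pa⁻ GH i ]⁺))

      -- Unfolding the well-founded recursion takes this congruence in place of function
      -- extensionality.
      extend-cong : ∀ X {v w : ∀ {Y} → TransClosure H._⟶_ Y X → Fitting (π Y)} →
                    (∀ {Y} (p : TransClosure H._⟶_ Y X) → v p ≡ w p) → extend X v ≡ extend X w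
      extend-cong X eq = cong (choose X (X ∈ˢ? H.inputs)) (gather-cong (H.Pa X) (λ i → eq [ Labels.∈-Pa⁻ GH i ]⁺))

      u : ∀ X → Fitting (π X)
      u = WfAll.wfRec (⟶⁺-wellFounded GH) 0ℓ (λ X → Fitting (π X)) extend

      u-unfold : ∀ X → u X ≡ choose X (X ∈ˢ? H.inputs) (gather (H.Pa X) (λ {Y} _ → u Y))
      u-unfold X = FixPoint.unfold-wfRec (⟶⁺-wellFounded GH) (λ X → Fitting (π X)) extend extend-cong

    valuation : H.Vertex → List Value
    valuation X = proj₁ (u X)

    valuation-fits : ∀ X → valuation X ≍ π X
    valuation-fits X = proj₂ (u X)

    private
      gather-u : ∀ A → proj₁ (gather A (λ {Y} _ → u Y)) ≡ concatMap valuation A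
      gather-u []      = refl
      gather-u (X ∷ A) = cong (valuation X ++_) (gather-u A)

    valuation-compatible : ∀ X X∉in {a} → ⟦ κ (H.Pa X) ⟧ (concatMap valuation (H.Pa X)) a →
                           ⟦ F₁ (H.c X X∉in) ⟧ a (valuation X)
    valuation-compatible X X∉in p rewrite u-unfold X =
      choose-compatible X (X ∈ˢ? H.inputs) (gather (H.Pa X) (λ {Y} _ → u Y)) X∉in
        (subst (λ x → ⟦ κ (H.Pa X) ⟧ x _) (sym (gather-u (H.Pa X))) p)

    valuation-names : ∀ X X∉in {p} → p ∈ S X X∉in → p ∈ᵛ valuation X
    valuation-names X X∉in rewrite u-unfold X = choose-names X (X ∈ˢ? H.inputs) _ X∉in

    valuation-input : ∀ X {p} → X ∈ˢ H.inputs → ¬ (p ∈ᵛ valuation X)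
    valuation-input X rewrite u-unfold X = choose-input X (X ∈ˢ? H.inputs) _

    -- Every output keeps the names of its mechanism, and d can only have produced them by its boxes.
    names-in-representative : ∀ {A B} (h : H.Diagram A B) (d : L.Diagram (F₀ A) (F₀ B)) → d L.≈ F₁ h →
      (∀ {X} → X ∈ A → X ∈ˢ H.inputs) →
      ∃[ T ] (map proj₁ T ≡ L.boxes d × (∀ {X} → X ∈ B → ∀ X∉in {p} → p ∈ S X X∉in → p ∈ T))
    names-in-representative {A} {B} h d d≈ A-inputs
      with a , p ← total (κ A) (vs-fits valuation valuation-fits valuation-compatible A)
      with b , q , s ← transport-valuation valuation valuation-fits valuation-compatible h p
      -- The inverse `κ⁻ B` takes `b` back to the values of the single variables in `B`, so
      -- `iso-names` finds all their names in `b`.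
      with y , q⁻ ← total (κ⁻ B) (cod (κ B) q)
      with _ , refl ← proj₁ (sound (proj₁ (proj₂ (κ-iso B)))) (_ , q , q⁻)
      with T , T-labels , k ← names-from-boxes d (proj₂ (sound d≈) s)
      = T , T-labels , λ X∈B X∉in i → in-T (k (iso-names (κ⁻-iso B) q⁻ (concatMap⁺ valuation (lose X∈B (valuation-names _ X∉in i)))))
      where
      in-T : ∀ {n} → n ∈ᵛ a ⊎ n ∈ T → n ∈ T
      in-T (inj₂ i) = i
      -- The inputs are nameless, so a name cannot come from `a`.
      in-T (inj₁ i) with X , X∈A , j ← find (concatMap⁻ valuation {xs = A} (iso-names (κ-iso A) p i)) =
        contradiction j (valuation-input X (A-inputs X∈A))

-- The two implications

module _ {a} {A : Set a} where

  unique-++⁻ : ∀ (xs : List A) {ys} → Unique (xs ++ ys) → Unique xs × Unique ys × Disjoint xs ys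
  unique-++⁻ []       u       = [] , u , λ ()
  unique-++⁻ (x ∷ xs) (p ∷ u) with v , w , disjoint ← unique-++⁻ xs u =
    All.tabulate (λ i → All.lookup p (∈-++⁺ˡ i)) ∷ v , w ,
    λ { (here refl , j) → All.lookup p (∈-++⁺ʳ xs j) refl ; (there i , j) → disjoint (i , j) }

module _ {a b} {A : Set a} {B : Set b} (f : A → List B) where

  unique-concatMap⁺ : ∀ {xs} → Unique xs → (∀ {x} → x ∈ xs → Unique (f x)) →
                      (∀ {x y} → x ∈ xs → y ∈ xs → x ≢ y → Disjoint (f x) (f y)) → Unique (concatMap f xs)
  unique-concatMap⁺ []       _      _        = []
  unique-concatMap⁺ {x ∷ xs} (x∉xs ∷ u) unique disjoint =
    ++⁺ (unique (here refl)) (unique-concatMap⁺ u (λ i → unique (there i)) (λ i j → disjoint (there i) (there j)))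
        λ (i , j) → let y , y∈xs , k = find (concatMap⁻ f {xs = xs} j) in
          disjoint (here refl) (there y∈xs) (All.lookup x∉xs y∈xs) (i , k)

  unique-concatMap⁻ : ∀ {xs x} → Unique (concatMap f xs) → x ∈ xs → Unique (f x)
  unique-concatMap⁻ {x ∷ xs} u (here refl) = proj₁ (unique-++⁻ (f x) u)
  unique-concatMap⁻ {x ∷ xs} u (there i)   = unique-concatMap⁻ (proj₁ (proj₂ (unique-++⁻ (f x) u))) i

  disjoint-concatMap⁻ : ∀ {xs x y} → Unique (concatMap f xs) → x ∈ xs → y ∈ xs → x ≢ y → Disjoint (f x) (f y)
  disjoint-concatMap⁻ {x ∷ xs} u (here refl) (here refl) x≢y _ = x≢y refl
  disjoint-concatMap⁻ {x ∷ xs} u (here refl) (there j)   _   (k , l) =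
    proj₂ (proj₂ (unique-++⁻ (f x) u)) (k , concatMap⁺ f (lose j l))
  disjoint-concatMap⁻ {x ∷ xs} u (there i)   (here refl) _   (k , l) =
    proj₂ (proj₂ (unique-++⁻ (f x) u)) (l , concatMap⁺ f (lose i k))
  disjoint-concatMap⁻ {x ∷ xs} u (there i)   (there j)   x≢y =
    disjoint-concatMap⁻ (proj₁ (proj₂ (unique-++⁻ (f x) u))) i j x≢y

module _ {a b} {A : Set a} {B : Set b} {f : A → B} where

  unique-map-injective : ∀ {zs x y} → Unique (map f zs) → x ∈ zs → y ∈ zs → f x ≡ f y → x ≡ y
  unique-map-injective (p ∷ u) (here refl) (here refl) _  = refl
  unique-map-injective (p ∷ u) (here refl) (there j)   eq = contradiction eq (All.lookup p (∈-map⁺ f j))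
  unique-map-injective (p ∷ u) (there i)   (here refl) eq = contradiction (sym eq) (All.lookup p (∈-map⁺ f i))
  unique-map-injective (p ∷ u) (there i)   (there j)   eq = unique-map-injective u i j eq

  -- Distinct images make `f` injective on `zs`, hence on `xs`.
  unique-map-⊆ : ∀ {xs zs} → Unique xs → (∀ {x} → x ∈ xs → x ∈ zs) → Unique (map f zs) → Unique (map f xs)
  unique-map-⊆ []          s w = []
  unique-map-⊆ (x∉xs ∷ u) s w = All.tabulate distinct ∷ unique-map-⊆ u (λ i → s (there i)) w
    where
    distinct : ∀ {y} → y ∈ map f _ → _ ≢ y
    distinct j eq with y , y∈xs , refl ← ∈-map⁻ f j =
      All.lookup x∉xs y∈xs (unique-map-injective w (s (here refl)) (s (there y∈xs)) eq)

module _ {n} (S : Subset n) where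

  ∈-elements⁺ : ∀ {x} → x ∈ˢ S → x ∈ elements S
  ∈-elements⁺ {x} = ∈-filter⁺ (_∈ˢ? S) (∈-allFin x)

  ∈-elements⁻ : ∀ {x} → x ∈ elements S → x ∈ˢ S
  ∈-elements⁻ i = proj₂ (∈-filter⁻ (_∈ˢ? S) {xs = allFin n} i)

  elements-unique : Unique (elements S)
  elements-unique = filter⁺ (_∈ˢ? S) (allFin⁺ n)

box-nonInput : (G : OpenDAG) → ∀ {A B} (d : Free.Diagram G A B) {X} → X ∈ Network.boxes G d → X ∉ˢ OpenDAG.inputs G
box-nonInput G (g Free.∘ f) i = [ box-nonInput G f , box-nonInput G g ]′ (∈-++⁻ (Network.boxes G f) i)
box-nonInput G (f Free.⊗ g) i = [ box-nonInput G f , box-nonInput G g ]′ (∈-++⁻ (Network.boxes G f) i)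
box-nonInput G (Free.c X X∉in) (here refl) = X∉in

Pa-unique : (G : OpenDAG) → ∀ X → Unique (OpenDAG.Pa G X)
Pa-unique G X = filter⁺ (_⟶? X) (allFin⁺ size)
  where open OpenDAG G

-- Distinctness of the boxes in the normal forms of the mechanisms

module DistinctBoxes (GL GH : OpenDAG) (F : CDFunctor (Free.category GH) (Free.category GL)) where
  private
    module L where
      open OpenDAG GL public
      open Free GL public
      open Network GL public
    module H where
      open OpenDAG GH public
      open Free GH public
      open Network GH public

  open CDFunctor F
  open Image GL GH F

  module _ (e : ∀ X → X ∉ˢ H.inputs → L.Diagram (F₀ (H.Pa X)) (π X))
           (e-represents : ∀ X X∉in → e X X∉in L.≈ F₁ (H.c X X∉in))
           (e-normal : ∀ X X∉in → Tightening.Normal GL (e X X∉in))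
           {A B} (h : H.Diagram A B) (A-inputs : ∀ {X} → X ∈ A → X ∈ˢ H.inputs)
           (B-nonInputs : ∀ {X} → X ∉ˢ H.inputs → X ∈ B)
           (d : L.Diagram (F₀ A) (F₀ B)) (d-represents : d L.≈ F₁ h) (d-unique : Unique (L.boxes d)) where

    private
      -- A box of `e X` is tagged with `X` and its position. Thus all boxes of all mechanisms have
      -- different names, whatever their labels.
      tags : ∀ X X∉in → List (ℕ × ℕ)
      tags X X∉in = map (toℕ X ,_) (upTo (length (L.boxes (e X X∉in))))

      tagged : ∀ X X∉in → ∃[ S ] (map proj₁ S ≡ L.boxes (e X X∉in) × map proj₂ S ≡ tags X X∉in)
      tagged X X∉in = ≍-zip (≍-length (tags X X∉in) (L.boxes (e X X∉in))
        (trans (length-map (toℕ X ,_) (upTo n)) (length-upTo n)))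
        where n = length (L.boxes (e X X∉in))

      S : ∀ X → X ∉ˢ H.inputs → List (L.Vertex × (ℕ × ℕ))
      S X X∉in = proj₁ (tagged X X∉in)

      S-labels : ∀ X X∉in → map proj₁ (S X X∉in) ≡ L.boxes (e X X∉in)
      S-labels X X∉in = proj₁ (proj₂ (tagged X X∉in))

      S-tags : ∀ X X∉in → map proj₂ (S X X∉in) ≡ tags X X∉in
      S-tags X X∉in = proj₂ (proj₂ (tagged X X∉in))

      S-unique : ∀ X X∉in → Unique (S X X∉in)
      S-unique X X∉in = map⁻ (subst Unique (sym (S-tags X X∉in)) (map⁺ (λ { refl → refl }) (upTo⁺ _)))

      S-tag : ∀ X X∉in {p} → p ∈ S X X∉in → proj₁ (proj₂ p) ≡ toℕ X
      S-tag X X∉in i = cong proj₁ (proj₂ (proj₂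
        (∈-map⁻ (toℕ X ,_) {xs = upTo _} (subst (_ ∈_) (S-tags X X∉in) (∈-map⁺ proj₂ i)))))

      box-tag : ∀ X X∉in {Z} → Z ∈ L.boxes (e X X∉in) → ∃[ p ] (p ∈ S X X∉in × Z ≡ proj₁ p)
      box-tag X X∉in i = ∈-map⁻ proj₁ (subst (_ ∈_) (sym (S-labels X X∉in)) i)

      collected : ∃[ T ] (map proj₁ T ≡ L.boxes d × (∀ {X} → X ∈ B → ∀ X∉in {p} → p ∈ S X X∉in → p ∈ T))
      collected = CompatibleValuation.names-in-representative GL GH F (0 , 0)
        e e-represents e-normal S S-labels h d d-represents A-inputs

      T : List (L.Vertex × (ℕ × ℕ))
      T = proj₁ collected

      T-unique : Unique (map proj₁ T)
      T-unique = subst Unique (sym (proj₁ (proj₂ collected))) d-unique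

      S⊆T : ∀ X X∉in {p} → p ∈ S X X∉in → p ∈ T
      S⊆T X X∉in = proj₂ (proj₂ collected) (B-nonInputs X∉in) X∉in

    -- The boxes of `e X` have distinct names, all of which lie in `T`, where a name is determined
    -- by its label.
    mechanism-boxes-unique : ∀ X X∉in → Unique (L.boxes (e X X∉in))
    mechanism-boxes-unique X X∉in = subst Unique (S-labels X X∉in) (unique-map-⊆ (S-unique X X∉in) (S⊆T X X∉in) T-unique)

    -- A common label belongs to a name from `X` and to one from `Y`. Both lie in `T`, whose labels
    -- are distinct, so the names agree, and the first component of the tag gives `X ≡ Y`.
    mechanism-boxes-disjoint : ∀ {X Y} X∉in Y∉in → X ≢ Y → Disjoint (L.boxes (e X X∉in)) (L.boxes (e Y Y∉in))
    mechanism-boxes-disjoint {X} {Y} X∉in Y∉in X≢Y (i , j) =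
      let p , p∈S , Z≡p = box-tag X X∉in i
          q , q∈S , Z≡q = box-tag Y Y∉in j
          p≡q = unique-map-injective T-unique (S⊆T X X∉in p∈S) (S⊆T Y Y∉in q∈S) (trans (sym Z≡p) Z≡q)
      in X≢Y (toℕ-injective (trans (sym (S-tag X X∉in p∈S)) (trans (cong (λ p → proj₁ (proj₂ p)) p≡q) (S-tag Y Y∉in q∈S))))

module Implications {o ℓ e} {𝒞 : MarkovCategory o ℓ e} (L H : CausalModel 𝒞) (πₛ : CDFunctor (𝐒 H) (𝐒 L)) where
  private
    module L where
      open CausalModel L public
      open Free dag public
      open Network dag public
    module H where
      open CausalModel H public
      open Free dag public
      open Network dag public

  open CDFunctor πₛ
  open Abstraction L H using (M; StructurallyWellBehaved)
  open Image L.dag H.dag πₛ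

  π-member : ∀ {A X W} → X ∈ A → W ∈ π X → W ∈ πs A
  π-member i j = concatMap⁺ π (lose i j)

  π-member⁻ : ∀ A {W} → W ∈ πs A → ∃[ X ] (X ∈ A × W ∈ π X)
  π-member⁻ A i = find (concatMap⁻ π {xs = A} i)

  parent-≢ : ∀ {X Y} → Y ∈ H.Pa X → Y ≢ X
  parent-≢ i refl = H.acyclic [ Labels.∈-Pa⁻ H.dag i ]⁺

  input-≢-nonInput : ∀ {X Y} → X ∈ˢ H.inputs → Y ∉ˢ H.inputs → X ≢ Y
  input-≢-nonInput X∈in Y∉in refl = Y∉in X∈in

  -- From well-behavedness to the conditions on the image

  module _ (swb : StructurallyWellBehaved πₛ) where
    open StructurallyWellBehaved swb

    private
      r : ∀ X → X ∉ˢ H.inputs → L.Diagram (F₀ (H.Pa X)) (π X)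
      r X X∉in = proj₁ (normalised-mechanisms X X∉in)

      r-represents : ∀ X X∉in → r X X∉in L.≈ F₁ (H.c X X∉in)
      r-represents X X∉in = proj₁ (proj₂ (normalised-mechanisms X X∉in))

      r-isNetwork : ∀ X X∉in → L.IsNetwork (r X X∉in)
      r-isNetwork X X∉in = proj₁ (proj₂ (proj₂ (normalised-mechanisms X X∉in)))

      r-wires : ∀ X X∉in → Unique (F₀ (H.Pa X)) × Unique (L.boxes (r X X∉in)) × Disjoint (F₀ (H.Pa X)) (L.boxes (r X X∉in))
      r-wires X X∉in = unique-++⁻ (F₀ (H.Pa X)) (L.IsNetwork.distinct-wires (r-isNetwork X X∉in))

      bs : H.Vertex → List L.Vertex
      bs = mechanismBoxes r r-represents

      bs-unique : ∀ X → X ∉ˢ H.inputs → Unique (bs X)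
      bs-unique X X∉in = subst Unique (sym (mechanismBoxes-nonInput r r-represents X X∉in)) (proj₁ (proj₂ (r-wires X X∉in)))

      -- A normalised diagram has a path through boxes from each box to `π X`. In a network diagram
      -- the boxes differ from the input labels, which are the elements of `π (Pa X)`, so this path
      -- avoids the latter.
      bs⊆M : ∀ X → X ∉ˢ H.inputs → ∀ {Z} → Z ∈ bs X → M πₛ X Z
      bs⊆M X X∉in {Z} i =
        let W , W∈πX , path = proj₂ (proj₂ (proj₂ (normalised-mechanisms X X∉in)))
                                (subst (Z ∈_) (mechanismBoxes-nonInput r r-represents X X∉in) i)
        in W , W∈πX , avoid path
        where
        avoids : ∀ {Z} → Z ∈ L.boxes (r X X∉in) → Z ∉ πs (H.Pa X)
        avoids i j = proj₂ (proj₂ (r-wires X X∉in)) (πs⇒F₀ (H.Pa X) j , i)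
        avoid : ∀ {Z W} → L.Path (_∈ L.boxes (r X X∉in)) Z W → L.Path (_∉ πs (H.Pa X)) Z W
        avoid (L.stop i)     = L.stop (avoids i)
        avoid (L.step i e p) = L.step (avoids i) e (avoid p)

      -- An input has no parents, so the path of length 0 has nothing to avoid.
      input⊆M : ∀ {X} → X ∈ˢ H.inputs → ∀ {Z} → Z ∈ π X → M πₛ X Z
      input⊆M {X} X∈in i = _ , i , L.stop λ j → let Y , Y∈Pa , _ = π-member⁻ (H.Pa X) j in
        H.inputs-parentless X∈in (Labels.∈-Pa⁻ H.dag Y∈Pa)

    -- Boxes from different mechanisms lie in `M` of different variables, and so do boxes and
    -- inputs; `M-disjoint` thus excludes repetitions among them.
    image-isNetworkDiagram : ∀ {A B} (h : H.Diagram A B) → Unique (H.boxes h) → (∀ {X} → X ∈ A → X ∈ˢ H.inputs) →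
                             Unique (πs A) → Unique (πs B) → L.IsNetworkDiagram (F₁ h)
    image-isNetworkDiagram {A} {B} h h-unique A-inputs πsA-unique πsB-unique =
      let d , d≈ , d-boxes = image-boxes r r-represents h
          h-nonInput = box-nonInput H.dag h
      in d , d≈ , record
        { distinct-wires = ++⁺ (F₀-unique A πsA-unique)
            (subst Unique (sym d-boxes) (unique-concatMap⁺ bs h-unique
              (λ i → bs-unique _ (h-nonInput i))
              (λ i j X≢Y (k , l) → M-disjoint X≢Y (bs⊆M _ (h-nonInput i) k , bs⊆M _ (h-nonInput j) l))))
            (λ (i , j) →
              let X , X∈A , k = π-member⁻ A (F₀⇒πs A i)
                  Y , Y∈h , l = find (concatMap⁻ bs {xs = H.boxes h} (subst (_ ∈_) d-boxes j))
              in M-disjoint (input-≢-nonInput (A-inputs X∈A) (h-nonInput Y∈h))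
                   (input⊆M (A-inputs X∈A) k , bs⊆M Y (h-nonInput Y∈h) l))
        ; distinct-outputs = F₀-unique B πsB-unique
        ; distinct-boxInputs = All.tabulate (λ {X} _ → Pa-unique L.dag X)
        }

    D-image-isNetworkDiagram : L.IsNetworkDiagram (F₁ (D H))
    D-image-isNetworkDiagram = image-isNetworkDiagram (D H)
      (Unique-resp-↭ (setoid _) (↭⇒↭ₛ (↭-sym (H.networkDiagram-boxes H.outputs)))
        (filter⁺ (H.isActive? H.outputs) (allFin⁺ H.size)))
      (∈-elements⁻ H.inputs) (proj₁ (proj₁ inputs-equal)) (proj₁ outputs-within)

    -- Every input of `L` lies in `π` of some input of `H`, so disjointness keeps it out of `π` of
    -- the non-inputs.
    image-nonInputs : ImageWithin π H.nonInputs L.nonInputs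
    image-nonInputs =
      unique-concatMap⁺ π (elements-unique H.nonInputs) (λ _ → no-repetitions _) (λ _ _ → disjoint) ,
      All.tabulate λ i → x∉p⇒x∈∁p λ Z∈in →
        let X , X∈nin , j = π-member⁻ (elements H.nonInputs) i
            Y , Y∈in , k = π-member⁻ (elements H.inputs) (proj₂ inputs-equal Z∈in)
        in disjoint (input-≢-nonInput (∈-elements⁻ H.inputs Y∈in) (x∈∁p⇒x∉p (∈-elements⁻ H.nonInputs X∈nin))) (k , j)

  -- From the conditions on the image to well-behavedness

  module _ (inputs-equal : ImageEquals π H.inputs L.inputs)
           (outputs-within : ImageWithin π H.outputs L.outputs)
           (nonInputs-within : ImageWithin π H.nonInputs L.nonInputs)
           (e : ∀ X → X ∉ˢ H.inputs → L.Diagram (F₀ (H.Pa X)) (π X))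
           (e-represents : ∀ X X∉in → e X X∉in L.≈ F₁ (H.c X X∉in))
           (e-normal : ∀ X X∉in → Tightening.Normal L.dag (e X X∉in))
           (boxes-unique : ∀ X X∉in → Unique (L.boxes (e X X∉in)))
           (boxes-disjoint : ∀ {X Y} X∉in Y∉in → X ≢ Y → Disjoint (L.boxes (e X X∉in)) (L.boxes (e Y Y∉in))) where

    private
      nonInput : ∀ {X} → X ∉ˢ H.inputs → X ∈ elements H.nonInputs
      nonInput X∉in = ∈-elements⁺ H.nonInputs (x∉p⇒x∈∁p X∉in)

      π-input : ∀ {X W} → X ∈ˢ H.inputs → W ∈ π X → W ∈ˢ L.inputs
      π-input X∈in i = All.lookup (proj₂ (proj₁ inputs-equal)) (π-member (∈-elements⁺ H.inputs X∈in) i)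

      π-nonInput : ∀ {X W} → X ∉ˢ H.inputs → W ∈ π X → W ∉ˢ L.inputs
      π-nonInput X∉in i = x∈∁p⇒x∉p (All.lookup (proj₂ nonInputs-within) (π-member (nonInput X∉in) i))

      π-unique : ∀ X → Unique (π X)
      π-unique X with X ∈ˢ? H.inputs
      ... | yes X∈in = unique-concatMap⁻ π (proj₁ (proj₁ inputs-equal)) (∈-elements⁺ H.inputs X∈in)
      ... | no  X∉in = unique-concatMap⁻ π (proj₁ nonInputs-within) (nonInput X∉in)

      π-disjoint : ∀ {X Y} → X ≢ Y → Disjoint (π X) (π Y)
      π-disjoint {X} {Y} X≢Y (i , j) with X ∈ˢ? H.inputs | Y ∈ˢ? H.inputs
      ... | yes X∈in | yes Y∈in = disjoint-concatMap⁻ π (proj₁ (proj₁ inputs-equal))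
              (∈-elements⁺ H.inputs X∈in) (∈-elements⁺ H.inputs Y∈in) X≢Y (i , j)
      ... | yes X∈in | no  Y∉in = π-nonInput Y∉in j (π-input X∈in i)
      ... | no  X∉in | yes Y∈in = π-nonInput X∉in i (π-input Y∈in j)
      ... | no  X∉in | no  Y∉in = disjoint-concatMap⁻ π (proj₁ nonInputs-within)
              (nonInput X∉in) (nonInput Y∉in) X≢Y (i , j)

      -- Otherwise the label would be that of an input wire of `e X`, hence in `π Y` for a parent
      -- `Y`, and `Y ≢ X` by acyclicity.
      output-box : ∀ {X} X∉in {W} → W ∈ π X → W ∈ L.boxes (e X X∉in)
      output-box {X} X∉in i with Labels.output-label L.dag (e X X∉in) i
      ... | inj₂ j = j
      ... | inj₁ j with Y , Y∈Pa , k ← π-member⁻ (H.Pa X) (F₀⇒πs (H.Pa X) j) =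
        contradiction (k , i) (π-disjoint (parent-≢ Y∈Pa))

      -- The labels of an input parent are inputs of `L`, which are never boxes; those of any other
      -- parent are boxes of its own mechanism, which differ from the boxes of `e X`.
      parents-disjoint : ∀ X X∉in → Disjoint (F₀ (H.Pa X)) (L.boxes (e X X∉in))
      parents-disjoint X X∉in (i , j) with Y , Y∈Pa , k ← π-member⁻ (H.Pa X) (F₀⇒πs (H.Pa X) i) with Y ∈ˢ? H.inputs
      ... | yes Y∈in = box-nonInput L.dag (e X X∉in) j (π-input Y∈in k)
      ... | no  Y∉in = boxes-disjoint Y∉in X∉in (parent-≢ Y∈Pa) (output-box Y∉in k , j)

      -- Follow the path backwards from `π X`: a parent of a box is again a box of `e X` or labels
      -- one of its inputs, and the input labels are in `π (Pa X)`, which the path avoids.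
      M⊆boxes : ∀ {X} X∉in {Z} → M πₛ X Z → Z ∈ L.boxes (e X X∉in)
      M⊆boxes {X} X∉in (_ , W∈πX , path) = follow path (output-box X∉in W∈πX)
        where
        follow : ∀ {Z W} → L.Path (_∉ πs (H.Pa X)) Z W → W ∈ L.boxes (e X X∉in) → Z ∈ L.boxes (e X X∉in)
        follow (L.stop _)        i = i
        follow (L.step Z∉ Z⟶ p) i
          with Labels.parent-label L.dag (e X X∉in) (follow p i) (∈-filter⁺ (L._⟶? _) (∈-allFin _) Z⟶)
        ... | inj₁ j = contradiction (F₀⇒πs (H.Pa X) j) Z∉
        ... | inj₂ j = j

      -- Here `π X` consists of inputs of `L`, which have no parents, so the path has length 0.
      M-input : ∀ {X} → X ∈ˢ H.inputs → ∀ {Z} → M πₛ X Z → Z ∈ π X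
      M-input {X} X∈in (_ , W∈πX , path) = follow path W∈πX
        where
        follow : ∀ {Z W} → L.Path (_∉ πs (H.Pa X)) Z W → W ∈ π X → Z ∈ π X
        follow (L.stop _)       i = i
        follow (L.step _ Z⟶ p) i = contradiction Z⟶ (L.inputs-parentless (π-input X∈in (follow p i)))

      M-disjoint : ∀ {X Y} → X ≢ Y → ∀ {Z} → ¬ (M πₛ X Z × M πₛ Y Z)
      M-disjoint {X} {Y} X≢Y (m , m′) with X ∈ˢ? H.inputs | Y ∈ˢ? H.inputs
      ... | yes X∈in | yes Y∈in = π-disjoint X≢Y (M-input X∈in m , M-input Y∈in m′)
      ... | yes X∈in | no  Y∉in = box-nonInput L.dag (e Y Y∉in) (M⊆boxes Y∉in m′) (π-input X∈in (M-input X∈in m))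
      ... | no  X∉in | yes Y∈in = box-nonInput L.dag (e X X∉in) (M⊆boxes X∉in m) (π-input Y∈in (M-input Y∈in m′))
      ... | no  X∉in | no  Y∉in = boxes-disjoint X∉in Y∉in X≢Y (M⊆boxes X∉in m , M⊆boxes Y∉in m′)

    structurallyWellBehaved : StructurallyWellBehaved πₛ
    structurallyWellBehaved = record
      { normalised-mechanisms = λ X X∉in →
          e X X∉in , e-represents X X∉in , record
            { distinct-wires = ++⁺ (F₀-unique (H.Pa X) (unique-concatMap⁺ π (Pa-unique H.dag X) (λ _ → π-unique _) (λ _ _ → π-disjoint)))
                (boxes-unique X X∉in) (parents-disjoint X X∉in)
            ; distinct-outputs = π-unique X
            ; distinct-boxInputs = All.tabulate (λ {Z} _ → Pa-unique L.dag Z)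
            } , Tightening.normal⇒normalised L.dag (e-normal X X∉in)
      ; no-repetitions = π-unique
      ; disjoint       = π-disjoint
      ; inputs-equal   = inputs-equal
      ; outputs-within = outputs-within
      ; M-disjoint     = M-disjoint
      }

lemma52 : ∀ {o ℓ e} (𝒞 : MarkovCategory o ℓ e) (L H : CausalModel 𝒞) →
    let open CausalModel
        open Abstraction L H
    in
    nonInputs H ⊆ outputs H →
    (πₛ : CDFunctor (𝐒 H) (𝐒 L)) →
    StructurallyWellBehaved πₛ
    ⇔
    (Network.IsNetworkDiagram (dag L) (CDFunctor.F₁ πₛ (D H))
    × ImageEquals (π πₛ) (inputs H) (inputs L)
    × ImageWithin (π πₛ) (outputs H) (outputs L)
    × ImageWithin (π πₛ) (nonInputs H) (nonInputs L))
lemma52 𝒞 L H nonInputs⊆outputs πₛ = mk⇔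
  (λ swb → D-image-isNetworkDiagram swb , inputs-equal swb , outputs-within swb , image-nonInputs swb)
  (λ ((d , d≈ , d-isNetwork) , inputs= , outputs⊆ , nonInputs⊆) →
    let d-unique = proj₁ (proj₂ (unique-++⁻ (F₀ (elements inputs)) (distinct-wires d-isNetwork)))
        -- The hypothesis `nonInputs⊆outputs` enters here: every mechanism ends in an output of
        -- `D H`, so the names of all its boxes reach the image.
        nonInput-output = λ {X} X∉in → ∈-elements⁺ outputs (nonInputs⊆outputs (x∉p⇒x∈∁p {x = X} X∉in))
    in structurallyWellBehaved inputs= outputs⊆ nonInputs⊆ nf nf-represents nf-normal
         (mechanism-boxes-unique nf nf-represents nf-normal (D H) (∈-elements⁻ inputs) nonInput-output d d≈ d-unique)
         (mechanism-boxes-disjoint nf nf-represents nf-normal (D H) (∈-elements⁻ inputs) nonInput-output d d≈ d-unique))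
  where
  open Abstraction.StructurallyWellBehaved using (inputs-equal; outputs-within)
  open Implications L H πₛ
  open DistinctBoxes (CausalModel.dag L) (CausalModel.dag H) πₛ
  open Tightening (CausalModel.dag L) using (normalise; Normal)
  open CausalModel H
  open CDFunctor πₛ using (F₀; F₁)
  open Network.IsNetwork using (distinct-wires)

  -- The diagram `d` represents only the image of the whole of `D H`; normal forms serve as the
  -- representatives for the single mechanisms.
  nf : ∀ X → X ∉ˢ inputs → Free.Diagram (CausalModel.dag L) (F₀ (Pa X)) (F₀ [ X ])
  nf X X∉in = proj₁ (normalise (F₁ (Free.c X X∉in)))

  nf-represents : ∀ X X∉in → Free._≈_ (CausalModel.dag L) (nf X X∉in) (F₁ (Free.c X X∉in))
  nf-represents X X∉in = proj₁ (proj₂ (normalise (F₁ (Free.c X X∉in))))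

  nf-normal : ∀ X X∉in → Normal (nf X X∉in)
  nf-normal X X∉in = proj₂ (proj₂ (normalise (F₁ (Free.c X X∉in))))
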